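{- Let $G$ be a graph with $m$ edges, minimum degree $\delta\ge 1$ and maximum degree $\Delta>\delta+1$. Let $A_0,A_1,A_2$ denote the cardinalities of the following sets of edges, respectively: $$F_0=\{uv\in E(G): d_u=\delta,\ d_v=\Delta\},$$ $$F_1=\{uv\in E(G): d_u=\delta,\ \delta<d_v<\Delta\},$$ $$F_2=\{uv\in E(G): d_u=\Delta,\ \delta<d_v<\Delta\}.$$ If $\alpha>0$ is real, then $$SDD_{\alpha}(G)\le(m-A_1-A_2)\left(\frac{\Delta^{\alpha}}{\delta^{\alpha}}+\frac{\delta^{\alpha}}{\Delta^{\alpha}}\right)+A_1\left(\frac{(\Delta-1)^{\alpha}}{\delta^{\alpha}}+\frac{\delta^{\alpha}}{(\Delta-1)^{\alpha}}\right)+A_2\left(\frac{\Delta^{\alpha}}{(\delta+1)^{\alpha}}+\frac{(\delta+1)^{\alpha}}{\Delta^{\alpha}}\right)$$ and $$SDD_{\alpha}(G)\ge 2m+A_0\left(\frac{\Delta^{\alpha}}{\delta^{\alpha}}+\frac{\delta^{\alpha}}{\Delta^{\alpha}}-2\right)+A_1\left(\frac{(\delta+1)^{\alpha}}{\delta^{\alpha}}+\frac{\delta^{\alpha}}{(\delta+1)^{\alpha}}-2\right)+A_2\left(\frac{\Delta^{\alpha}}{(\Delta-1)^{\alpha}}+\frac{(\Delta-1)^{\alpha}}{\Delta^{\alpha}}-2\right).$$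
   Context: Graphs are finite, simple and undirected. For a graph $G$ with edge set $E(G)$, $d_u$ denotes the degree of the vertex $u$, and $uv$ denotes the (unordered) edge joining $u$ and $v$; in the definitions of sets of edges by conditions on $d_u,d_v$, an edge belongs to the set if its endpoints can be named $u,v$ so that the conditions hold. For $\alpha\in\mathbb{R}$, the variable symmetric division deg index is $$SDD_\alpha(G)=\sum_{uv\in E(G)}\left(\frac{d_u^\alpha}{d_v^\alpha}+\frac{d_v^\alpha}{d_u^\alpha}\right).$$ -}

module Defs where

open import Data.Empty using (⊥-elim)
open import Data.Fin.Base as Fin using (Fin)
import Data.Fin.Properties as Fin
open import Data.Integer.Base as ℤ using (+_)
import Data.Integer.Properties as ℤ
open import Data.List.Base using (List; allFin; cartesianProduct; filter; foldr; length; map)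
open import Data.Nat.Base as ℕ using (ℕ; zero; suc)
import Data.Nat.Properties as ℕ
open import Data.Product.Base using (_×_; _,_; proj₁; proj₂; ∃-syntax)
open import Data.Rational.Base as ℚ using (ℚ; 0ℚ; 1ℚ; ½; ∣_∣)
import Data.Rational.Properties as ℚ
import Data.Rational.Unnormalised.Base as ℚᵘ
import Data.Rational.Unnormalised.Properties as ℚᵘ
open import Data.Sum.Base using (_⊎_; inj₁; inj₂)
open import Level using (0ℓ)
open import Relation.Binary.Core using (Rel)
open import Relation.Binary.Definitions using (Decidable; Irreflexive; Symmetric)
open import Relation.Binary.PropositionalEquality
open import Relation.Nullary using (yes; no)
open import Relation.Nullary.Decidable using (_×-dec_; _⊎-dec_)

open import Algebra.Bundles using (CommutativeRing)
import Algebra.Properties.CommutativeSemiring.Exp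
  (CommutativeRing.commutativeSemiring ℚ.+-*-commutativeRing) as Exp

-- Operations on ℝ act termwise on Cauchy sequences.  This module checks that
-- the resulting sequences are again Cauchy.
module Sequences where

  open import Data.Rational.Base using (_+_; _*_; _-_; -_; _≤_; _<_; _/_)
  open Exp public using (_^_)
  open import Data.Rational.Solver using (module +-*-Solver)
  open +-*-Solver using (solve; con; _:=_; _:+_; _:*_; _:-_; :-_)

  IsCauchy : (ℕ → ℚ) → Set
  IsCauchy f = ∀ ε → 0ℚ < ε →
    ∃[ N ] (∀ m n → N ℕ.≤ m → N ℕ.≤ n → ∣ f m - f n ∣ ≤ ε)

  -- A total reciprocal with the convention 1/0 = 0.
  recip : ℚ → ℚ
  recip p with p ℚ.≟ 0ℚ
  ... | yes _   = 0ℚ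
  ... | no p≢0 = (ℚ.1/ p) {{ℚ.≢-nonZero p≢0}}

  -- Σ_{i=1}^{n} yⁱ/i, a partial sum of the Mercator series for - log (1 - y)
  mercator : ℚ → ℕ → ℚ
  mercator y zero    = 0ℚ
  mercator y (suc n) = mercator y n + y ^ suc n * (+ 1 / suc n)

  -- (1 + x/2ⁿ)^(2ⁿ), which tends to eˣ.
  euler : ℚ → ℕ → ℚ
  euler x n = (1ℚ + x * ½ ^ n) ^ (2 ℕ.^ n)

  0≤1 : 0ℚ ≤ 1ℚ
  0≤1 = ℚ.nonNegative⁻¹ 1ℚ

  0<1 : 0ℚ < 1ℚ
  0<1 = ℚ.positive⁻¹ 1ℚ

  0≤½ : 0ℚ ≤ ½
  0≤½ = ℚ.nonNegative⁻¹ ½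

  0<½ : 0ℚ < ½
  0<½ = ℚ.positive⁻¹ ½

  *-monoʳ : ∀ r {p q} → 0ℚ ≤ r → p ≤ q → r * p ≤ r * q
  *-monoʳ r 0≤r = ℚ.*-monoˡ-≤-nonNeg r {{ℚ.nonNegative 0≤r}}

  *-monoˡ : ∀ r {p q} → 0ℚ ≤ r → p ≤ q → p * r ≤ q * r
  *-monoˡ r 0≤r = ℚ.*-monoʳ-≤-nonNeg r {{ℚ.nonNegative 0≤r}}

  *-mono : ∀ {a b c d} → 0ℚ ≤ b → 0ℚ ≤ c → a ≤ b → c ≤ d → a * c ≤ b * d
  *-mono {b = b} {c} 0≤b 0≤c a≤b c≤d =
    ℚ.≤-trans (*-monoˡ c 0≤c a≤b) (*-monoʳ b 0≤b c≤d)

  0≤* : ∀ {p q} → 0ℚ ≤ p → 0ℚ ≤ q → 0ℚ ≤ p * q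
  0≤* {p} {q} 0≤p 0≤q = subst (_≤ p * q) (ℚ.*-zeroʳ p) (*-monoʳ p 0≤p 0≤q)

  0<* : ∀ {p q} → 0ℚ < p → 0ℚ < q → 0ℚ < p * q
  0<* {p} {q} 0<p 0<q =
    subst (_< p * q) (ℚ.*-zeroʳ p) (ℚ.*-monoʳ-<-pos p {{ℚ.positive 0<p}} 0<q)

  0≤+ : ∀ {p q} → 0ℚ ≤ p → 0ℚ ≤ q → 0ℚ ≤ p + q
  0≤+ = ℚ.+-mono-≤

  *-cancelˡ : ∀ r {p q} → 0ℚ < r → r * p ≤ r * q → p ≤ q
  *-cancelˡ r 0<r = ℚ.*-cancelˡ-≤-pos r {{ℚ.positive 0<r}}

  ≤⇒0≤- : ∀ {p q} → p ≤ q → 0ℚ ≤ q - p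
  ≤⇒0≤- {p} {q} p≤q = subst (_≤ q - p) (ℚ.+-inverseʳ p) (ℚ.+-monoˡ-≤ (- p) p≤q)

  0≤-⇒≤ : ∀ {p q} → 0ℚ ≤ q - p → p ≤ q
  0≤-⇒≤ {p} {q} h = subst₂ _≤_ (ℚ.+-identityˡ p)
    (solve 2 (λ p q → (q :- p) :+ p := q) refl p q) (ℚ.+-monoˡ-≤ p h)

  p≤p+q : ∀ {p q} → 0ℚ ≤ q → p ≤ p + q
  p≤p+q {p} {q} 0≤q = subst (_≤ p + q) (ℚ.+-identityʳ p) (ℚ.+-monoʳ-≤ p 0≤q)

  p-q≤p : ∀ {p q} → 0ℚ ≤ q → p - q ≤ p
  p-q≤p {p} {q} 0≤q = subst (p - q ≤_) (ℚ.+-identityʳ p)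
    (ℚ.+-monoʳ-≤ p (ℚ.neg-antimono-≤ 0≤q))

  p≤∣p∣ : ∀ p → p ≤ ∣ p ∣
  p≤∣p∣ p with ℚ.≤-total 0ℚ p
  ... | inj₁ 0≤p = ℚ.≤-reflexive (sym (ℚ.0≤p⇒∣p∣≡p 0≤p))
  ... | inj₂ p≤0 = ℚ.≤-trans p≤0 (ℚ.0≤∣p∣ p)

  -∣p∣≤p : ∀ p → - ∣ p ∣ ≤ p
  -∣p∣≤p p = subst₂ _≤_ (cong -_ (ℚ.∣-p∣≡∣p∣ p)) (solve 1 (λ p → :- (:- p) := p) refl p)
    (ℚ.neg-antimono-≤ (p≤∣p∣ (- p)))

  ∣-∣-sym : ∀ p q → ∣ p - q ∣ ≡ ∣ q - p ∣
  ∣-∣-sym p q = trans (sym (ℚ.∣-p∣≡∣p∣ (p - q)))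
    (cong ∣_∣ (solve 2 (λ p q → :- (p :- q) := q :- p) refl p q))

  ∣-∣-triangle : ∀ p q r → ∣ p - r ∣ ≤ ∣ p - q ∣ + ∣ q - r ∣
  ∣-∣-triangle p q r = subst (λ z → ∣ z ∣ ≤ ∣ p - q ∣ + ∣ q - r ∣)
    (solve 3 (λ p q r → (p :- q) :+ (q :- r) := p :- r) refl p q r)
    (ℚ.∣p+q∣≤∣p∣+∣q∣ (p - q) (q - r))

  half+half : ∀ p → ½ * p + ½ * p ≡ p
  half+half = solve 1 (λ p → con ½ :* p :+ con ½ :* p := p) refl

  p*recip[p]≡1 : ∀ {p} → 0ℚ < p → p * recip p ≡ 1ℚ
  p*recip[p]≡1 {p} 0<p with p ℚ.≟ 0ℚ
  ... | yes p≡0 = ⊥-elim (ℚ.<⇒≢ 0<p (sym p≡0))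
  ... | no  p≢0 = ℚ.*-inverseʳ p {{ℚ.≢-nonZero p≢0}}

  0<recip : ∀ {p} → 0ℚ < p → 0ℚ < recip p
  0<recip {p} 0<p = ℚ.*-cancelˡ-<-nonNeg p {{ℚ.nonNegative (ℚ.<⇒≤ 0<p)}}
    (subst₂ _<_ (sym (ℚ.*-zeroʳ p)) (sym (p*recip[p]≡1 0<p)) 0<1)

  shrink : ∀ K ε → 0ℚ ≤ K → 0ℚ < ε → ∃[ η ] (0ℚ < η × K * η ≤ ε)
  shrink K ε 0≤K 0<ε = ε * r , 0<* 0<ε 0<r , (begin
      K * (ε * r)            ≤⟨ p≤p+q (ℚ.<⇒≤ (0<* 0<ε 0<r)) ⟩
      K * (ε * r) + ε * r    ≡⟨ solve 3 (λ K ε r → K :* (ε :* r) :+ ε :* r := ε :* ((con 1ℚ :+ K) :* r)) refl K ε r ⟩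
      ε * ((1ℚ + K) * r)     ≡⟨ cong (ε *_) (p*recip[p]≡1 0<1+K) ⟩
      ε * 1ℚ                 ≡⟨ ℚ.*-identityʳ ε ⟩
      ε                      ∎)
    where
    open ℚ.≤-Reasoning
    0<1+K : 0ℚ < 1ℚ + K
    0<1+K = ℚ.<-≤-trans 0<1 (p≤p+q 0≤K)
    r = recip (1ℚ + K)
    0<r = 0<recip 0<1+K

  ι : ℕ → ℚ
  ι n = + n / 1

  ι-suc : ∀ n → ι (suc n) ≡ 1ℚ + ι n
  ι-suc n = ℚ.toℚᵘ-injective (ℚᵘ.≃-trans (ℚ.toℚᵘ-fromℚᵘ (ℚᵘ.mkℚᵘ (+ suc n) 0))
    (ℚᵘ.≃-sym (ℚᵘ.≃-trans (ℚ.toℚᵘ-homo-+ 1ℚ (ι n))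
      (ℚᵘ.≃-trans (ℚᵘ.+-congʳ ℚᵘ.1ℚᵘ (ℚ.toℚᵘ-fromℚᵘ (ℚᵘ.mkℚᵘ (+ n) 0)))
        (ℚᵘ.*≡* (cong (λ k → (+ 1 ℤ.+ k) ℤ.* + 1) (ℤ.*-identityʳ (+ n))))))))

  0≤ι : ∀ n → 0ℚ ≤ ι n
  0≤ι zero    = ℚ.≤-refl
  0≤ι (suc n) = subst (0ℚ ≤_) (sym (ι-suc n)) (0≤+ 0≤1 (0≤ι n))

  1≤ι-suc : ∀ n → 1ℚ ≤ ι (suc n)
  1≤ι-suc n = subst (1ℚ ≤_) (sym (ι-suc n)) (p≤p+q (0≤ι n))

  0<ι-suc : ∀ n → 0ℚ < ι (suc n)
  0<ι-suc n = ℚ.<-≤-trans 0<1 (1≤ι-suc n)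

  ι*/ : ∀ k n → ι (suc n) * (+ k / suc n) ≡ ι k
  ι*/ k n = ℚ.toℚᵘ-injective (ℚᵘ.≃-trans (ℚ.toℚᵘ-homo-* (ι (suc n)) (+ k / suc n))
    (ℚᵘ.≃-trans (ℚᵘ.*-cong (ℚ.toℚᵘ-fromℚᵘ (ℚᵘ.mkℚᵘ (+ suc n) 0)) (ℚ.toℚᵘ-fromℚᵘ (ℚᵘ.mkℚᵘ (+ k) n)))
      (ℚᵘ.≃-trans (ℚᵘ.*≡* eq) (ℚᵘ.≃-sym (ℚ.toℚᵘ-fromℚᵘ (ℚᵘ.mkℚᵘ (+ k) 0))))))
    where
    eq : (+ suc n ℤ.* + k) ℤ.* + 1 ≡ + k ℤ.* + (1 ℕ.* suc n)
    eq = trans (ℤ.*-identityʳ _) (trans (ℤ.*-comm (+ suc n) (+ k))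
      (cong (λ z → + k ℤ.* + z) (sym (ℕ.*-identityˡ (suc n)))))

  ≤ι : ∀ p → ∃[ n ] p ≤ ι n
  ≤ι p@(ℚ.mkℚ (+ k) d-1 _) = k , ℚ.toℚᵘ-cancel-≤
    (ℚᵘ.≤-trans (ℚᵘ.*≤* (ℤ.≤-trans (ℤ.≤-reflexive (ℤ.*-identityʳ (+ k)))
                  (ℤ.≤-trans (ℤ.≤-reflexive (sym (ℤ.*-identityʳ (+ k))))
                    (ℤ.*-monoˡ-≤-nonNeg (+ k) {+ 1} {+ suc d-1} (ℤ.+≤+ (ℕ.s≤s ℕ.z≤n))))))
      (ℚᵘ.≤-reflexive (ℚᵘ.≃-sym (ℚ.toℚᵘ-fromℚᵘ (ℚᵘ.mkℚᵘ (+ k) 0)))))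
  ≤ι p@(ℚ.mkℚ (ℤ.-[1+ k ]) d-1 _) = 0 , ℚ.<⇒≤ (ℚ.negative⁻¹ p)

  0≤^ : ∀ {p} n → 0ℚ ≤ p → 0ℚ ≤ p ^ n
  0≤^ zero    _   = 0≤1
  0≤^ (suc n) 0≤p = 0≤* 0≤p (0≤^ n 0≤p)

  0<^ : ∀ {p} n → 0ℚ < p → 0ℚ < p ^ n
  0<^ zero    _   = 0<1
  0<^ (suc n) 0<p = 0<* 0<p (0<^ n 0<p)

  ^-mono : ∀ {p q} n → 0ℚ ≤ p → p ≤ q → p ^ n ≤ q ^ n
  ^-mono zero    _   _   = ℚ.≤-refl
  ^-mono (suc n) 0≤p p≤q =
    *-mono (ℚ.≤-trans 0≤p p≤q) (0≤^ n 0≤p) p≤q (^-mono n 0≤p p≤q)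

  1^ : ∀ n → 1ℚ ^ n ≡ 1ℚ
  1^ zero    = refl
  1^ (suc n) = trans (ℚ.*-identityˡ _) (1^ n)

  ∣∣^≤ : ∀ {p B} n → ∣ p ∣ ≤ B → ∣ p ^ n ∣ ≤ B ^ n
  ∣∣^≤ zero    _ = ℚ.≤-refl
  ∣∣^≤ {p} {B} (suc n) ∣p∣≤B = subst (_≤ B * B ^ n) (sym (ℚ.∣p*q∣≡∣p∣*∣q∣ p (p ^ n)))
    (*-mono (ℚ.≤-trans (ℚ.0≤∣p∣ p) ∣p∣≤B) (ℚ.0≤∣p∣ (p ^ n)) ∣p∣≤B (∣∣^≤ n ∣p∣≤B))

  dbl : ∀ p n → p ^ (2 ℕ.^ suc n) ≡ p ^ (2 ℕ.^ n) * p ^ (2 ℕ.^ n)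
  dbl p n = trans (cong (p ^_) (cong (2 ℕ.^ n ℕ.+_) (ℕ.+-identityʳ (2 ℕ.^ n))))
    (Exp.^-homo-* p (2 ℕ.^ n) (2 ℕ.^ n))

  dbl′ : ∀ p n → p ^ (2 ℕ.^ suc n) ≡ (p * p) ^ (2 ℕ.^ n)
  dbl′ p n = trans (dbl p n) (sym (Exp.^-distrib-* p p (2 ℕ.^ n)))

  -- With q = 1 - 1/d, Bernoulli's inequality gives qⁿ ≤ d/(d + n).
  module Geometric (q d : ℚ) (0≤q : 0ℚ ≤ q) (1≤d : 1ℚ ≤ d) (qd : q * d + 1ℚ ≡ d) where

    0≤d : 0ℚ ≤ d
    0≤d = ℚ.≤-trans 0≤1 1≤d

    q≤1 : q ≤ 1ℚ
    q≤1 = *-cancelˡ d (ℚ.<-≤-trans 0<1 1≤d) (subst₂ _≤_ (ℚ.*-comm q d)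
      (trans qd (sym (ℚ.*-identityʳ d))) (p≤p+q 0≤1))

    bernoulli : ∀ n → q ^ n * (d + ι n) ≤ d
    bernoulli zero = ℚ.≤-reflexive (trans (ℚ.*-identityˡ _) (ℚ.+-identityʳ d))
    bernoulli (suc n) = begin
      q * q ^ n * (d + ι (suc n))          ≡⟨ cong (λ z → q * q ^ n * (d + z)) (ι-suc n) ⟩
      q * q ^ n * (d + (1ℚ + ι n))         ≡⟨ solve 4 (λ q Q d i → q :* Q :* (d :+ (con 1ℚ :+ i)) := Q :* (q :* d :+ q :* (con 1ℚ :+ i))) refl q (q ^ n) d (ι n) ⟩
      q ^ n * (q * d + q * (1ℚ + ι n))     ≤⟨ *-monoʳ (q ^ n) (0≤^ n 0≤q) (ℚ.+-monoʳ-≤ (q * d)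
                                                (*-monoˡ (1ℚ + ι n) (0≤+ 0≤1 (0≤ι n)) q≤1)) ⟩
      q ^ n * (q * d + 1ℚ * (1ℚ + ι n))    ≡⟨ cong (q ^ n *_) (solve 2 (λ z i → z :+ con 1ℚ :* (con 1ℚ :+ i) := z :+ con 1ℚ :+ i) refl (q * d) (ι n)) ⟩
      q ^ n * (q * d + 1ℚ + ι n)           ≡⟨ cong (λ z → q ^ n * (z + ι n)) qd ⟩
      q ^ n * (d + ι n)                    ≤⟨ bernoulli n ⟩
      d                                    ∎
      where open ℚ.≤-Reasoning

    ^-suc-≤ : ∀ n → q ^ suc n ≤ q ^ n
    ^-suc-≤ n = subst (q ^ suc n ≤_) (ℚ.*-identityˡ (q ^ n)) (*-monoˡ (q ^ n) (0≤^ n 0≤q) q≤1)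

    ^-antimono : ∀ j n → q ^ (j ℕ.+ n) ≤ q ^ n
    ^-antimono zero    n = ℚ.≤-refl
    ^-antimono (suc j) n = ℚ.≤-trans (^-suc-≤ (j ℕ.+ n)) (^-antimono j n)

    small : ∀ C ε → 0ℚ ≤ C → 0ℚ < ε → ∃[ N ] (∀ n → N ℕ.≤ n → C * q ^ n ≤ ε)
    small C ε 0≤C 0<ε = suc k , bound
      where
      open ℚ.≤-Reasoning
      k = proj₁ (≤ι (C * d * recip ε))
      N = suc k
      at-N : C * q ^ N ≤ ε
      at-N = *-cancelˡ (ι N) (0<ι-suc k) (begin
        ι N * (C * q ^ N)          ≤⟨ subst₂ _≤_ (solve 3 (λ i C Q → C :* (Q :* i) := i :* (C :* Q)) refl (ι N) C (q ^ N)) refl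
                                       (*-monoʳ C 0≤C (ℚ.≤-trans (*-monoʳ (q ^ N) (0≤^ N 0≤q)
                                         (subst (_≤ d + ι N) (ℚ.+-identityˡ (ι N)) (ℚ.+-monoˡ-≤ (ι N) 0≤d)))
                                         (bernoulli N))) ⟩
        C * d                      ≡⟨ ℚ.*-identityʳ (C * d) ⟨
        C * d * 1ℚ                 ≡⟨ cong (C * d *_) (p*recip[p]≡1 0<ε) ⟨
        C * d * (ε * recip ε)      ≡⟨ solve 3 (λ c e r → c :* (e :* r) := c :* r :* e) refl (C * d) ε (recip ε) ⟩
        C * d * recip ε * ε        ≤⟨ *-monoˡ ε (ℚ.<⇒≤ 0<ε) (proj₂ (≤ι (C * d * recip ε))) ⟩
        ι k * ε                    ≤⟨ *-monoˡ ε (ℚ.<⇒≤ 0<ε) (subst (ι k ≤_) (trans (ℚ.+-comm (ι k) 1ℚ) (sym (ι-suc k))) (p≤p+q 0≤1)) ⟩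
        ι N * ε                    ∎)
      bound : ∀ n → N ℕ.≤ n → C * q ^ n ≤ ε
      bound n N≤n = ℚ.≤-trans (*-monoʳ C 0≤C
        (subst (λ z → q ^ z ≤ q ^ N) (ℕ.m∸n+n≡m N≤n) (^-antimono (n ℕ.∸ N) N))) at-N

    telescope : ∀ (f : ℕ → ℚ) D N → 0ℚ ≤ D →
      (∀ n → N ℕ.≤ n → ∣ f (suc n) - f n ∣ ≤ D * (q ^ n - q ^ suc n)) →
      ∀ n m → N ℕ.≤ n → n ℕ.≤ m → ∣ f m - f n ∣ ≤ D * q ^ n
    telescope f D N 0≤D step n m N≤n n≤m =
      subst (λ z → ∣ f z - f n ∣ ≤ D * q ^ n) (ℕ.m∸n+n≡m n≤m) (ℚ.≤-trans (go (m ℕ.∸ n))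
        (*-monoʳ D 0≤D (p-q≤p (0≤^ (m ℕ.∸ n ℕ.+ n) 0≤q))))
      where
      open ℚ.≤-Reasoning
      go : ∀ j → ∣ f (j ℕ.+ n) - f n ∣ ≤ D * (q ^ n - q ^ (j ℕ.+ n))
      go zero = ℚ.≤-reflexive (trans (cong ∣_∣ (ℚ.+-inverseʳ (f n)))
        (sym (trans (cong (D *_) (ℚ.+-inverseʳ (q ^ n))) (ℚ.*-zeroʳ D))))
      go (suc j) = begin
        ∣ f (suc (j ℕ.+ n)) - f n ∣
          ≤⟨ ∣-∣-triangle (f (suc (j ℕ.+ n))) (f (j ℕ.+ n)) (f n) ⟩
        ∣ f (suc (j ℕ.+ n)) - f (j ℕ.+ n) ∣ + ∣ f (j ℕ.+ n) - f n ∣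
          ≤⟨ ℚ.+-mono-≤ (step (j ℕ.+ n) (ℕ.≤-trans N≤n (ℕ.m≤n+m n j))) (go j) ⟩
        D * (q ^ (j ℕ.+ n) - q ^ suc (j ℕ.+ n)) + D * (q ^ n - q ^ (j ℕ.+ n))
          ≡⟨ solve 4 (λ D a b c → D :* (a :- b) :+ D :* (c :- a) := D :* (c :- b)) refl
               D (q ^ (j ℕ.+ n)) (q ^ suc (j ℕ.+ n)) (q ^ n) ⟩
        D * (q ^ n - q ^ suc (j ℕ.+ n)) ∎

  cauchy-from : ∀ f → (∀ ε → 0ℚ < ε → ∃[ N ] (∀ n → N ℕ.≤ n → ∣ f n - f N ∣ ≤ ε)) → IsCauchy f
  cauchy-from f h ε 0<ε with N , hN ← h (½ * ε) (0<* 0<½ 0<ε) = N , λ m n N≤m N≤n → begin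
      ∣ f m - f n ∣                  ≤⟨ ∣-∣-triangle (f m) (f N) (f n) ⟩
      ∣ f m - f N ∣ + ∣ f N - f n ∣  ≤⟨ ℚ.+-mono-≤ (hN m N≤m) (subst (_≤ ½ * ε) (∣-∣-sym (f n) (f N)) (hN n N≤n)) ⟩
      ½ * ε + ½ * ε                  ≡⟨ half+half ε ⟩
      ε                              ∎
    where open ℚ.≤-Reasoning

  cauchy-bounded : ∀ f → IsCauchy f →
    ∃[ B ] (0ℚ ≤ B × ∃[ N ] (∀ n → N ℕ.≤ n → ∣ f n ∣ ≤ B))
  cauchy-bounded f cf with N , hN ← cf 1ℚ 0<1 =
    1ℚ + ∣ f N ∣ , 0≤+ 0≤1 (ℚ.0≤∣p∣ (f N)) , N , λ n N≤n → begin
      ∣ f n ∣                     ≡⟨ cong ∣_∣ (solve 2 (λ a b → a := (a :- b) :+ b) refl (f n) (f N)) ⟩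
      ∣ (f n - f N) + f N ∣       ≤⟨ ℚ.∣p+q∣≤∣p∣+∣q∣ (f n - f N) (f N) ⟩
      ∣ f n - f N ∣ + ∣ f N ∣     ≤⟨ ℚ.+-monoˡ-≤ ∣ f N ∣ (hN n N N≤n ℕ.≤-refl) ⟩
      1ℚ + ∣ f N ∣                ∎
    where open ℚ.≤-Reasoning

  cauchy-const : ∀ p → IsCauchy (λ _ → p)
  cauchy-const p ε 0<ε = 0 , λ _ _ _ _ →
    subst (_≤ ε) (sym (cong ∣_∣ (ℚ.+-inverseʳ p))) (ℚ.<⇒≤ 0<ε)

  cauchy-+ : ∀ f g → IsCauchy f → IsCauchy g → IsCauchy (λ n → f n + g n)
  cauchy-+ f g cf cg ε 0<ε
    with M , hM ← cf (½ * ε) (0<* 0<½ 0<ε) | N , hN ← cg (½ * ε) (0<* 0<½ 0<ε) =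
    M ℕ.⊔ N , λ m n m≥ n≥ → begin
      ∣ (f m + g m) - (f n + g n) ∣     ≡⟨ cong ∣_∣ (solve 4 (λ a b c d → (a :+ b) :- (c :+ d) := (a :- c) :+ (b :- d)) refl (f m) (g m) (f n) (g n)) ⟩
      ∣ (f m - f n) + (g m - g n) ∣     ≤⟨ ℚ.∣p+q∣≤∣p∣+∣q∣ (f m - f n) (g m - g n) ⟩
      ∣ f m - f n ∣ + ∣ g m - g n ∣     ≤⟨ ℚ.+-mono-≤ (hM m n (ℕ.m⊔n≤o⇒m≤o M N m≥) (ℕ.m⊔n≤o⇒m≤o M N n≥))
                                                       (hN m n (ℕ.m⊔n≤o⇒n≤o M N m≥) (ℕ.m⊔n≤o⇒n≤o M N n≥)) ⟩
      ½ * ε + ½ * ε                     ≡⟨ half+half ε ⟩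
      ε                                 ∎
    where open ℚ.≤-Reasoning

  cauchy-neg : ∀ f → IsCauchy f → IsCauchy (λ n → - f n)
  cauchy-neg f cf ε 0<ε with N , hN ← cf ε 0<ε = N , λ m n m≥ n≥ →
    subst (_≤ ε) (trans (sym (ℚ.∣-p∣≡∣p∣ (f m - f n)))
      (cong ∣_∣ (ℚ.neg-distrib-+ (f m) (- f n)))) (hN m n m≥ n≥)

  product-diff : ∀ {A B η θ} a b c d → 0ℚ ≤ A → 0ℚ ≤ B →
    ∣ a ∣ ≤ A → ∣ d ∣ ≤ B → ∣ b - d ∣ ≤ η → ∣ a - c ∣ ≤ θ →
    ∣ a * b - c * d ∣ ≤ A * η + B * θ
  product-diff {A} {B} {η} {θ} a b c d 0≤A 0≤B a≤ d≤ b-d≤ a-c≤ = begin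
    ∣ a * b - c * d ∣
      ≡⟨ cong ∣_∣ (solve 4 (λ a b c d → a :* b :- c :* d := a :* (b :- d) :+ d :* (a :- c)) refl a b c d) ⟩
    ∣ a * (b - d) + d * (a - c) ∣
      ≤⟨ ℚ.∣p+q∣≤∣p∣+∣q∣ (a * (b - d)) (d * (a - c)) ⟩
    ∣ a * (b - d) ∣ + ∣ d * (a - c) ∣
      ≡⟨ cong₂ _+_ (ℚ.∣p*q∣≡∣p∣*∣q∣ a (b - d)) (ℚ.∣p*q∣≡∣p∣*∣q∣ d (a - c)) ⟩
    ∣ a ∣ * ∣ b - d ∣ + ∣ d ∣ * ∣ a - c ∣
      ≤⟨ ℚ.+-mono-≤ (*-mono 0≤A (ℚ.0≤∣p∣ (b - d)) a≤ b-d≤) (*-mono 0≤B (ℚ.0≤∣p∣ (a - c)) d≤ a-c≤) ⟩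
    A * η + B * θ ∎
    where open ℚ.≤-Reasoning

  cauchy-* : ∀ f g → IsCauchy f → IsCauchy g → IsCauchy (λ n → f n * g n)
  cauchy-* f g cf cg ε 0<ε =
    let A , 0≤A , M₀ , hA = cauchy-bounded f cf
        B , 0≤B , N₀ , hB = cauchy-bounded g cg
        η , 0<η , Aη = shrink A (½ * ε) 0≤A (0<* 0<½ 0<ε)
        θ , 0<θ , Bθ = shrink B (½ * ε) 0≤B (0<* 0<½ 0<ε)
        M , hM = cf θ 0<θ
        N , hN = cg η 0<η
    in (M₀ ℕ.⊔ N₀) ℕ.⊔ (M ℕ.⊔ N) , λ m n m≥ n≥ →
      let m≥₁ = ℕ.m⊔n≤o⇒m≤o (M₀ ℕ.⊔ N₀) (M ℕ.⊔ N) m≥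
          n≥₁ = ℕ.m⊔n≤o⇒m≤o (M₀ ℕ.⊔ N₀) (M ℕ.⊔ N) n≥
          m≥₂ = ℕ.m⊔n≤o⇒n≤o (M₀ ℕ.⊔ N₀) (M ℕ.⊔ N) m≥
          n≥₂ = ℕ.m⊔n≤o⇒n≤o (M₀ ℕ.⊔ N₀) (M ℕ.⊔ N) n≥
      in ℚ.≤-trans
        (product-diff (f m) (g m) (f n) (g n) 0≤A 0≤B
          (hA m (ℕ.m⊔n≤o⇒m≤o M₀ N₀ m≥₁)) (hB n (ℕ.m⊔n≤o⇒n≤o M₀ N₀ n≥₁))
          (hN m n (ℕ.m⊔n≤o⇒n≤o M N m≥₂) (ℕ.m⊔n≤o⇒n≤o M N n≥₂))
          (hM m n (ℕ.m⊔n≤o⇒m≤o M N m≥₂) (ℕ.m⊔n≤o⇒m≤o M N n≥₂)))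
        (subst (A * η + B * θ ≤_) (half+half ε) (ℚ.+-mono-≤ Aη Bθ))

  EventuallyPositive : (ℕ → ℚ) → Set
  EventuallyPositive f = ∃[ c ] (0ℚ < c × ∃[ N ] (∀ n → N ℕ.≤ n → c ≤ f n))

  recip-antimono : ∀ {p q} → 0ℚ < p → p ≤ q → recip q ≤ recip p
  recip-antimono {p} {q} 0<p p≤q = *-cancelˡ q 0<q (begin
    q * recip q          ≡⟨ p*recip[p]≡1 0<q ⟩
    1ℚ                   ≡⟨ p*recip[p]≡1 0<p ⟨
    p * recip p          ≤⟨ *-monoˡ (recip p) (ℚ.<⇒≤ (0<recip 0<p)) p≤q ⟩
    q * recip p          ∎)
    where
    open ℚ.≤-Reasoning
    0<q = ℚ.<-≤-trans 0<p p≤q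

  recip-diff : ∀ {p q} → 0ℚ < p → 0ℚ < q → recip p - recip q ≡ (recip p * recip q) * (q - p)
  recip-diff {p} {q} 0<p 0<q = begin
    r - s                              ≡⟨ cong₂ _-_ (ℚ.*-identityʳ r) (ℚ.*-identityʳ s) ⟨
    r * 1ℚ - s * 1ℚ                    ≡⟨ cong₂ (λ a b → r * a - s * b) (p*recip[p]≡1 0<q) (p*recip[p]≡1 0<p) ⟨
    r * (q * s) - s * (p * r)          ≡⟨ solve 4 (λ p q r s → r :* (q :* s) :- s :* (p :* r) := (r :* s) :* (q :- p)) refl p q r s ⟩
    (r * s) * (q - p)                  ∎
    where
    open ≡-Reasoning
    r = recip p
    s = recip q

  recip-lipschitz : ∀ {c η} p q → 0ℚ < c → c ≤ p → c ≤ q → ∣ q - p ∣ ≤ η →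
    ∣ recip p - recip q ∣ ≤ recip c * recip c * η
  recip-lipschitz {c} {η} p q 0<c c≤p c≤q q-p≤η = begin
    ∣ r - s ∣                      ≡⟨ cong ∣_∣ (recip-diff 0<p 0<q) ⟩
    ∣ (r * s) * (q - p) ∣          ≡⟨ ℚ.∣p*q∣≡∣p∣*∣q∣ (r * s) (q - p) ⟩
    ∣ r * s ∣ * ∣ q - p ∣          ≡⟨ cong (_* ∣ q - p ∣) (ℚ.0≤p⇒∣p∣≡p (0≤* (ℚ.<⇒≤ (0<recip 0<p)) 0≤s)) ⟩
    r * s * ∣ q - p ∣              ≤⟨ *-mono (0≤* 0≤k 0≤k) (ℚ.0≤∣p∣ (q - p))
                                        (*-mono 0≤k 0≤s (recip-antimono 0<c c≤p) (recip-antimono 0<c c≤q)) q-p≤η ⟩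
    recip c * recip c * η          ∎
    where
    open ℚ.≤-Reasoning
    r = recip p
    s = recip q
    0<p = ℚ.<-≤-trans 0<c c≤p
    0<q = ℚ.<-≤-trans 0<c c≤q
    0≤s = ℚ.<⇒≤ (0<recip 0<q)
    0≤k = ℚ.<⇒≤ (0<recip 0<c)

  cauchy-recip : ∀ f → IsCauchy f → EventuallyPositive f → IsCauchy (λ n → recip (f n))
  cauchy-recip f cf (c , 0<c , N₀ , hc) ε 0<ε =
    let 0≤k = ℚ.<⇒≤ (0<recip 0<c)
        η , 0<η , Kη = shrink (recip c * recip c) ε (0≤* 0≤k 0≤k) 0<ε
        N , hN = cf η 0<η
    in N₀ ℕ.⊔ N , λ m n m≥ n≥ → ℚ.≤-trans
      (recip-lipschitz (f m) (f n) 0<c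
        (hc m (ℕ.m⊔n≤o⇒m≤o N₀ N m≥)) (hc n (ℕ.m⊔n≤o⇒m≤o N₀ N n≥))
        (hN n m (ℕ.m⊔n≤o⇒n≤o N₀ N n≥) (ℕ.m⊔n≤o⇒n≤o N₀ N m≥)))
      Kη

  module MercatorCauchy (k : ℕ) where

    d = ι (suc k)
    y = + k / suc k

    0≤y : 0ℚ ≤ y
    0≤y = *-cancelˡ d (0<ι-suc k) (subst₂ _≤_ (sym (ℚ.*-zeroʳ d)) (sym (ι*/ k k)) (0≤ι k))

    yd+1≡d : y * d + 1ℚ ≡ d
    yd+1≡d = trans (cong (_+ 1ℚ) (trans (ℚ.*-comm y d) (ι*/ k k)))
      (trans (ℚ.+-comm (ι k) 1ℚ) (sym (ι-suc k)))

    open Geometric y d 0≤y (1≤ι-suc k) yd+1≡d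

    step : ∀ n → 0 ℕ.≤ n → ∣ mercator y (suc n) - mercator y n ∣ ≤ d * (y ^ n - y ^ suc n)
    step n _ = begin
      ∣ mercator y n + t - mercator y n ∣    ≡⟨ cong ∣_∣ (solve 2 (λ a t → a :+ t :- a := t) refl (mercator y n) t) ⟩
      ∣ t ∣                                  ≡⟨ ℚ.0≤p⇒∣p∣≡p (0≤* (0≤^ (suc n) 0≤y) 0≤i) ⟩
      y ^ suc n * i                          ≤⟨ *-mono (0≤^ n 0≤y) 0≤i (^-suc-≤ n) i≤1 ⟩
      y ^ n * 1ℚ                             ≡⟨ solve 3 (λ Y z d → Y :* con 1ℚ := Y :* (z :+ con 1ℚ) :- Y :* z) refl (y ^ n) (y * d) d ⟩
      y ^ n * (y * d + 1ℚ) - y ^ n * (y * d) ≡⟨ cong (λ z → y ^ n * z - y ^ n * (y * d)) yd+1≡d ⟩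
      y ^ n * d - y ^ n * (y * d)            ≡⟨ solve 3 (λ Y y d → Y :* d :- Y :* (y :* d) := d :* (Y :- y :* Y)) refl (y ^ n) y d ⟩
      d * (y ^ n - y ^ suc n)                ∎
      where
      open ℚ.≤-Reasoning
      i = + 1 / suc n
      t = y ^ suc n * i
      0≤i : 0ℚ ≤ i
      0≤i = *-cancelˡ (ι (suc n)) (0<ι-suc n)
        (subst₂ _≤_ (sym (ℚ.*-zeroʳ (ι (suc n)))) (sym (ι*/ 1 n)) 0≤1)
      i≤1 : i ≤ 1ℚ
      i≤1 = *-cancelˡ (ι (suc n)) (0<ι-suc n)
        (subst₂ _≤_ (sym (ι*/ 1 n)) (sym (ℚ.*-identityʳ (ι (suc n)))) (1≤ι-suc n))

    mercator-cauchy : IsCauchy (mercator y)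
    mercator-cauchy = cauchy-from (mercator y) λ ε 0<ε →
      let N , hN = small d ε 0≤d 0<ε in
      N , λ n N≤n → ℚ.≤-trans (telescope (mercator y) d 0 0≤d step N n ℕ.z≤n N≤n) (hN N ℕ.≤-refl)

  module Half = Geometric ½ (ι 2) 0≤½ (1≤ι-suc 1) refl

  pow-lipschitz : ∀ {a b C} n → 1ℚ ≤ C → ∣ a ∣ ≤ C → ∣ b ∣ ≤ C →
    ½ ^ n * ∣ a ^ (2 ℕ.^ n) - b ^ (2 ℕ.^ n) ∣ ≤ ∣ a - b ∣ * C ^ (2 ℕ.^ n)
  pow-lipschitz {a} {b} {C} zero 1≤C _ _ = begin
    1ℚ * ∣ a * 1ℚ - b * 1ℚ ∣  ≡⟨ trans (ℚ.*-identityˡ _) (cong₂ (λ x y → ∣ x - y ∣) (ℚ.*-identityʳ a) (ℚ.*-identityʳ b)) ⟩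
    ∣ a - b ∣                 ≡⟨ ℚ.*-identityʳ _ ⟨
    ∣ a - b ∣ * 1ℚ            ≤⟨ *-monoʳ ∣ a - b ∣ (ℚ.0≤∣p∣ (a - b)) (subst (1ℚ ≤_) (sym (ℚ.*-identityʳ C)) 1≤C) ⟩
    ∣ a - b ∣ * (C * 1ℚ)      ∎
    where open ℚ.≤-Reasoning
  pow-lipschitz {a} {b} {C} (suc n) 1≤C ∣a∣≤C ∣b∣≤C = begin
    ½ * ½ ^ n * ∣ a ^ (2 ℕ.^ suc n) - b ^ (2 ℕ.^ suc n) ∣
      ≡⟨ cong (λ z → ½ * ½ ^ n * ∣ z ∣) (trans (cong₂ _-_ (dbl a n) (dbl b n))
           (solve 2 (λ x y → x :* x :- y :* y := (x :- y) :* (x :+ y)) refl A B)) ⟩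
    ½ * ½ ^ n * ∣ (A - B) * (A + B) ∣
      ≡⟨ cong (½ * ½ ^ n *_) (ℚ.∣p*q∣≡∣p∣*∣q∣ (A - B) (A + B)) ⟩
    ½ * ½ ^ n * (∣ A - B ∣ * ∣ A + B ∣)
      ≡⟨ solve 4 (λ h k x y → h :* k :* (x :* y) := (k :* x) :* (h :* y)) refl ½ (½ ^ n) ∣ A - B ∣ ∣ A + B ∣ ⟩
    (½ ^ n * ∣ A - B ∣) * (½ * ∣ A + B ∣)
      ≤⟨ *-mono (0≤* (ℚ.0≤∣p∣ (a - b)) 0≤D) (0≤* 0≤½ (ℚ.0≤∣p∣ (A + B)))
           (pow-lipschitz n 1≤C ∣a∣≤C ∣b∣≤C)
           (*-monoʳ ½ 0≤½ (ℚ.≤-trans (ℚ.∣p+q∣≤∣p∣+∣q∣ A B)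
             (ℚ.+-mono-≤ (∣∣^≤ (2 ℕ.^ n) ∣a∣≤C) (∣∣^≤ (2 ℕ.^ n) ∣b∣≤C)))) ⟩
    (∣ a - b ∣ * D) * (½ * (D + D))
      ≡⟨ solve 2 (λ x D → (x :* D) :* (con ½ :* (D :+ D)) := x :* (D :* D)) refl ∣ a - b ∣ D ⟩
    ∣ a - b ∣ * (D * D)
      ≡⟨ cong (∣ a - b ∣ *_) (dbl C n) ⟨
    ∣ a - b ∣ * C ^ (2 ℕ.^ suc n) ∎
    where
    open ℚ.≤-Reasoning
    A = a ^ (2 ℕ.^ n)
    B = b ^ (2 ℕ.^ n)
    D = C ^ (2 ℕ.^ n)
    0≤D : 0ℚ ≤ D
    0≤D = 0≤^ (2 ℕ.^ n) (ℚ.≤-trans 0≤1 1≤C)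

  module EulerBounds (B : ℚ) (0≤B : 0ℚ ≤ B) where

    h : ℕ → ℚ
    h n = ½ ^ n

    0≤h : ∀ n → 0ℚ ≤ h n
    0≤h n = 0≤^ n 0≤½

    0<h : ∀ n → 0ℚ < h n
    0<h n = 0<^ n 0<½

    0≤Bh : ∀ n → 0ℚ ≤ B * h n
    0≤Bh n = 0≤* 0≤B (0≤h n)

    start : ∃[ N ] (∀ n → N ℕ.≤ n → B * h n ≤ ½)
    start = Half.small B ½ 0≤B 0<½

    n₀ = proj₁ start

    c : ℚ
    c = ½ ^ (2 ℕ.^ n₀)

    0<c : 0ℚ < c
    0<c = 0<^ (2 ℕ.^ n₀) 0<½

    ½≤1-Bh : ∀ n → n₀ ℕ.≤ n → ½ ≤ 1ℚ - B * h n
    ½≤1-Bh n n≥ = ℚ.+-monoʳ-≤ 1ℚ (ℚ.neg-antimono-≤ (proj₂ start n n≥))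

    lower : ∀ n → n₀ ℕ.≤ n → c ≤ (1ℚ - B * h n) ^ (2 ℕ.^ n)
    lower n n≥ = subst (λ z → c ≤ (1ℚ - B * h z) ^ (2 ℕ.^ z)) (ℕ.m∸n+n≡m n≥) (go (n ℕ.∸ n₀))
      where
      go : ∀ j → c ≤ (1ℚ - B * h (j ℕ.+ n₀)) ^ (2 ℕ.^ (j ℕ.+ n₀))
      go zero    = ^-mono (2 ℕ.^ n₀) 0≤½ (½≤1-Bh n₀ ℕ.≤-refl)
      go (suc j) = ℚ.≤-trans (go j) (subst ((1ℚ - B * h k) ^ (2 ℕ.^ k) ≤_) (sym (dbl′ _ k))
        (^-mono (2 ℕ.^ k) (ℚ.≤-trans 0≤½ (½≤1-Bh k (ℕ.m≤n+m n₀ j)))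
          (subst (1ℚ - B * h k ≤_)
            (solve 2 (λ B h → (con 1ℚ :- B :* h) :+ (B :* (con ½ :* h)) :* (B :* (con ½ :* h))
                        := (con 1ℚ :- B :* (con ½ :* h)) :* (con 1ℚ :- B :* (con ½ :* h))) refl B (h k))
            (p≤p+q (0≤* (0≤Bh (suc k)) (0≤Bh (suc k)))))))
        where k = j ℕ.+ n₀

    K : ℚ
    K = recip c

    0≤K : 0ℚ ≤ K
    0≤K = ℚ.<⇒≤ (0<recip 0<c)

    C : ℕ → ℚ
    C n = 1ℚ + B * h n

    1≤C : ∀ n → 1ℚ ≤ C n
    1≤C n = p≤p+q (0≤Bh n)

    0≤C : ∀ n → 0ℚ ≤ C n
    0≤C n = ℚ.≤-trans 0≤1 (1≤C n)

    upper : ∀ n → n₀ ℕ.≤ n → C n ^ (2 ℕ.^ n) ≤ K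
    upper n n≥ = *-cancelˡ c 0<c (begin
      c * U                            ≤⟨ *-monoˡ U (0≤^ N (0≤C n)) (lower n n≥) ⟩
      (1ℚ - B * h n) ^ N * U           ≡⟨ Exp.^-distrib-* (1ℚ - B * h n) (C n) N ⟨
      ((1ℚ - B * h n) * C n) ^ N       ≤⟨ ^-mono N (0≤* (ℚ.≤-trans 0≤½ (½≤1-Bh n n≥)) (0≤C n))
                                            (subst (_≤ 1ℚ) (solve 1 (λ z → con 1ℚ :- z :* z := (con 1ℚ :- z) :* (con 1ℚ :+ z)) refl (B * h n))
                                              (p-q≤p (0≤* (0≤Bh n) (0≤Bh n)))) ⟩
      1ℚ ^ N                           ≡⟨ 1^ N ⟩
      1ℚ                               ≡⟨ p*recip[p]≡1 0<c ⟨
      c * K                            ∎)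
      where
      open ℚ.≤-Reasoning
      N = 2 ℕ.^ n
      U = C n ^ N

    base≤C : ∀ {x} n → ∣ x ∣ ≤ B → ∣ 1ℚ + x * h n ∣ ≤ C n
    base≤C {x} n ∣x∣≤B = ℚ.≤-trans (ℚ.∣p+q∣≤∣p∣+∣q∣ 1ℚ (x * h n))
      (ℚ.+-monoʳ-≤ 1ℚ (subst (_≤ B * h n)
        (sym (trans (ℚ.∣p*q∣≡∣p∣*∣q∣ x (h n)) (cong (∣ x ∣ *_) (ℚ.0≤p⇒∣p∣≡p (0≤h n)))))
        (*-monoˡ (h n) (0≤h n) ∣x∣≤B)))

    euler-lower : ∀ {x} n → n₀ ℕ.≤ n → ∣ x ∣ ≤ B → c ≤ euler x n
    euler-lower {x} n n≥ ∣x∣≤B = ℚ.≤-trans (lower n n≥)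
      (^-mono (2 ℕ.^ n) (ℚ.≤-trans 0≤½ (½≤1-Bh n n≥))
        (ℚ.+-monoʳ-≤ 1ℚ (subst (_≤ x * h n) (sym (ℚ.neg-distribˡ-* B (h n)))
          (*-monoˡ (h n) (0≤h n) (ℚ.≤-trans (ℚ.neg-antimono-≤ ∣x∣≤B) (-∣p∣≤p x))))))

    lipschitz : ∀ {x y} n → n₀ ℕ.≤ n → ∣ x ∣ ≤ B → ∣ y ∣ ≤ B →
      ∣ euler x n - euler y n ∣ ≤ K * ∣ x - y ∣
    lipschitz {x} {y} n n≥ ∣x∣≤B ∣y∣≤B = *-cancelˡ (h n) (0<h n) (begin
      h n * ∣ euler x n - euler y n ∣
        ≤⟨ pow-lipschitz n (1≤C n) (base≤C n ∣x∣≤B) (base≤C n ∣y∣≤B) ⟩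
      ∣ (1ℚ + x * h n) - (1ℚ + y * h n) ∣ * C n ^ (2 ℕ.^ n)
        ≡⟨ cong (λ z → ∣ z ∣ * C n ^ (2 ℕ.^ n))
             (solve 3 (λ x y h → (con 1ℚ :+ x :* h) :- (con 1ℚ :+ y :* h) := h :* (x :- y)) refl x y (h n)) ⟩
      ∣ h n * (x - y) ∣ * C n ^ (2 ℕ.^ n)
        ≡⟨ cong (_* C n ^ (2 ℕ.^ n)) (trans (ℚ.∣p*q∣≡∣p∣*∣q∣ (h n) (x - y)) (cong (_* ∣ x - y ∣) (ℚ.0≤p⇒∣p∣≡p (0≤h n)))) ⟩
      h n * ∣ x - y ∣ * C n ^ (2 ℕ.^ n)
        ≤⟨ *-monoʳ (h n * ∣ x - y ∣) (0≤* (0≤h n) (ℚ.0≤∣p∣ (x - y))) (upper n n≥) ⟩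
      h n * ∣ x - y ∣ * K
        ≡⟨ solve 3 (λ h d K → h :* d :* K := h :* (K :* d)) refl (h n) ∣ x - y ∣ K ⟩
      h n * (K * ∣ x - y ∣) ∎)
      where open ℚ.≤-Reasoning

    D : ℚ
    D = B * B * K

    0≤D : 0ℚ ≤ D
    0≤D = 0≤* (0≤* 0≤B 0≤B) 0≤K

    step : ∀ {x} → ∣ x ∣ ≤ B → ∀ n → n₀ ℕ.≤ n →
      ∣ euler x (suc n) - euler x n ∣ ≤ D * (½ ^ n - ½ ^ suc n)
    step {x} ∣x∣≤B n n≥ = *-cancelˡ (h n) (0<h n) (begin
      h n * ∣ a ^ (2 ℕ.^ suc n) - b ^ (2 ℕ.^ n) ∣
        ≡⟨ cong (λ z → h n * ∣ z - b ^ (2 ℕ.^ n) ∣) (dbl′ a n) ⟩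
      h n * ∣ (a * a) ^ (2 ℕ.^ n) - b ^ (2 ℕ.^ n) ∣
        ≤⟨ pow-lipschitz n 1≤CC ∣aa∣≤CC (ℚ.≤-trans (base≤C n ∣x∣≤B) C≤CC) ⟩
      ∣ a * a - b ∣ * CC ^ (2 ℕ.^ n)
        ≡⟨ cong₂ _*_ (trans (cong ∣_∣ (solve 2 (λ x h →
               (con 1ℚ :+ x :* (con ½ :* h)) :* (con 1ℚ :+ x :* (con ½ :* h)) :- (con 1ℚ :+ x :* h)
               := (x :* (con ½ :* h)) :* (x :* (con ½ :* h))) refl x (h n)))
             (ℚ.∣p*q∣≡∣p∣*∣q∣ (x * h′) (x * h′))) (sym (dbl′ (C (suc n)) n)) ⟩
      ∣ x * h′ ∣ * ∣ x * h′ ∣ * C (suc n) ^ (2 ℕ.^ suc n)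
        ≤⟨ *-mono (0≤* (0≤Bh (suc n)) (0≤Bh (suc n))) (0≤^ (2 ℕ.^ suc n) (0≤C (suc n)))
             (*-mono (0≤Bh (suc n)) (ℚ.0≤∣p∣ (x * h′)) ∣xh∣≤ ∣xh∣≤)
             (upper (suc n) (ℕ.m≤n⇒m≤1+n n≥)) ⟩
      (B * h′) * (B * h′) * K
        ≤⟨ *-monoˡ K 0≤K (subst ((B * h′) * (B * h′) ≤_)
             (solve 2 (λ B h → (B :* (con ½ :* h)) :* (B :* (con ½ :* h)) :+ (B :* (con ½ :* h)) :* (B :* (con ½ :* h))
                := h :* (B :* B :* (h :- con ½ :* h))) refl B (h n))
             (p≤p+q (0≤* (0≤Bh (suc n)) (0≤Bh (suc n))))) ⟩
      h n * (B * B * (h n - h′)) * K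
        ≡⟨ solve 4 (λ h b d K → h :* (b :* d) :* K := h :* (b :* K :* d)) refl (h n) (B * B) (h n - h′) K ⟩
      h n * (D * (h n - h′)) ∎)
      where
      open ℚ.≤-Reasoning
      h′ = h (suc n)
      a = 1ℚ + x * h′
      b = 1ℚ + x * h n
      CC = C (suc n) * C (suc n)
      ∣xh∣≤ : ∣ x * h′ ∣ ≤ B * h′
      ∣xh∣≤ = subst (_≤ B * h′)
        (sym (trans (ℚ.∣p*q∣≡∣p∣*∣q∣ x h′) (cong (∣ x ∣ *_) (ℚ.0≤p⇒∣p∣≡p (0≤h (suc n))))))
        (*-monoˡ h′ (0≤h (suc n)) ∣x∣≤B)
      ∣aa∣≤CC : ∣ a * a ∣ ≤ CC
      ∣aa∣≤CC = subst (_≤ CC) (sym (ℚ.∣p*q∣≡∣p∣*∣q∣ a a))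
        (*-mono (0≤C (suc n)) (ℚ.0≤∣p∣ a) (base≤C (suc n) ∣x∣≤B) (base≤C (suc n) ∣x∣≤B))
      C≤CC : C n ≤ CC
      C≤CC = subst (C n ≤_) (solve 2 (λ B h → (con 1ℚ :+ B :* h) :+ (B :* (con ½ :* h)) :* (B :* (con ½ :* h))
               := (con 1ℚ :+ B :* (con ½ :* h)) :* (con 1ℚ :+ B :* (con ½ :* h))) refl B (h n))
        (p≤p+q (0≤* (0≤Bh (suc n)) (0≤Bh (suc n))))
      1≤CC : 1ℚ ≤ CC
      1≤CC = ℚ.≤-trans (1≤C n) C≤CC

    diagonal : ∀ {η n N} x y → n₀ ℕ.≤ N → N ℕ.≤ n → ∣ x ∣ ≤ B → ∣ y ∣ ≤ B →
      ∣ x - y ∣ ≤ η → ∣ euler x n - euler y N ∣ ≤ K * η + D * ½ ^ N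
    diagonal {η} {n} {N} x y N≥ N≤n ∣x∣≤B ∣y∣≤B x-y≤η = begin
      ∣ euler x n - euler y N ∣
        ≤⟨ ∣-∣-triangle (euler x n) (euler y n) (euler y N) ⟩
      ∣ euler x n - euler y n ∣ + ∣ euler y n - euler y N ∣
        ≤⟨ ℚ.+-mono-≤
             (ℚ.≤-trans (lipschitz n (ℕ.≤-trans N≥ N≤n) ∣x∣≤B ∣y∣≤B) (*-monoʳ K 0≤K x-y≤η))
             (Half.telescope (euler y) D n₀ 0≤D (step ∣y∣≤B) N n N≥ N≤n) ⟩
      K * η + D * ½ ^ N ∎
      where open ℚ.≤-Reasoning

    euler-cauchy : ∀ f → IsCauchy f → ∀ N₀ → (∀ n → N₀ ℕ.≤ n → ∣ f n ∣ ≤ B) →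
      IsCauchy (λ n → euler (f n) n)
    euler-cauchy f cf N₀ hB = cauchy-from (λ n → euler (f n) n) λ ε 0<ε →
      let η , 0<η , Kη = shrink K (½ * ε) 0≤K (0<* 0<½ 0<ε)
          N₁ , h₁ = cf η 0<η
          N₂ , h₂ = Half.small D (½ * ε) 0≤D (0<* 0<½ 0<ε)
          N = (N₀ ℕ.⊔ n₀) ℕ.⊔ (N₁ ℕ.⊔ N₂)
          N≥N₀ = ℕ.≤-trans (ℕ.m≤m⊔n N₀ n₀) (ℕ.m≤m⊔n (N₀ ℕ.⊔ n₀) (N₁ ℕ.⊔ N₂))
          N≥n₀ = ℕ.≤-trans (ℕ.m≤n⊔m N₀ n₀) (ℕ.m≤m⊔n (N₀ ℕ.⊔ n₀) (N₁ ℕ.⊔ N₂))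
          N≥N₁ = ℕ.≤-trans (ℕ.m≤m⊔n N₁ N₂) (ℕ.m≤n⊔m (N₀ ℕ.⊔ n₀) (N₁ ℕ.⊔ N₂))
          N≥N₂ = ℕ.≤-trans (ℕ.m≤n⊔m N₁ N₂) (ℕ.m≤n⊔m (N₀ ℕ.⊔ n₀) (N₁ ℕ.⊔ N₂))
      in N , λ n N≤n → ℚ.≤-trans
        (diagonal (f n) (f N) N≥n₀ N≤n (hB n (ℕ.≤-trans N≥N₀ N≤n)) (hB N N≥N₀)
          (h₁ n N (ℕ.≤-trans N≥N₁ N≤n) N≥N₁))
        (subst (K * η + D * ½ ^ N ≤_) (half+half ε) (ℚ.+-mono-≤ Kη (h₂ N N≥N₂)))

  cauchy-euler : ∀ f → IsCauchy f → IsCauchy (λ n → euler (f n) n)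
  cauchy-euler f cf =
    let B , 0≤B , N₀ , hB = cauchy-bounded f cf in EulerBounds.euler-cauchy B 0≤B f cf N₀ hB

  euler-positive : ∀ f → IsCauchy f → EventuallyPositive (λ n → euler (f n) n)
  euler-positive f cf =
    let B , 0≤B , N₀ , hB = cauchy-bounded f cf
        open EulerBounds B 0≤B
    in c , 0<c , N₀ ℕ.⊔ n₀ , λ n n≥ →
      euler-lower {f n} n (ℕ.m⊔n≤o⇒n≤o N₀ n₀ n≥) (hB n (ℕ.m⊔n≤o⇒m≤o N₀ n₀ n≥))

open Sequences using (IsCauchy; recip; mercator; euler)

record ℝ : Set where
  constructor mkℝ
  field
    seq    : ℕ → ℚ
    cauchy : IsCauchy seq

open ℝ public

infix  4 _≤_ _<_
infixl 6 _+_ _-_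
infixl 7 _*_ _/_
infixr 8 _^_
infix  8 -_

_≤_ : Rel ℝ 0ℓ
x ≤ y = ∀ ε → 0ℚ ℚ.< ε → ∃[ N ] (∀ n → N ℕ.≤ n → seq x n ℚ.≤ seq y n ℚ.+ ε)

_<_ : Rel ℝ 0ℓ
x < y = ∃[ ε ] (0ℚ ℚ.< ε × ∃[ N ] (∀ n → N ℕ.≤ n → seq x n ℚ.+ ε ℚ.≤ seq y n))

fromℚ : ℚ → ℝ
fromℚ p = mkℝ (λ _ → p) (Sequences.cauchy-const p)

fromℕ : ℕ → ℝ
fromℕ n = fromℚ (+ n ℚ./ 1)

_+_ : ℝ → ℝ → ℝ
x + y = mkℝ (λ n → seq x n ℚ.+ seq y n) (Sequences.cauchy-+ (seq x) (seq y) (cauchy x) (cauchy y))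

-_ : ℝ → ℝ
- x = mkℝ (λ n → ℚ.- seq x n) (Sequences.cauchy-neg (seq x) (cauchy x))

_-_ : ℝ → ℝ → ℝ
x - y = x + (- y)

_*_ : ℝ → ℝ → ℝ
x * y = mkℝ (λ n → seq x n ℚ.* seq y n) (Sequences.cauchy-* (seq x) (seq y) (cauchy x) (cauchy y))

record ℝ⁺ : Set where
  constructor mkℝ⁺
  field
    value    : ℝ
    positive : fromℕ 0 < value

open ℝ⁺ public

_⁻¹ : ℝ⁺ → ℝ
(mkℝ⁺ x (c , 0<c , N , hN)) ⁻¹ = mkℝ (λ n → recip (seq x n))
  (Sequences.cauchy-recip (seq x) (cauchy x)
    (c , 0<c , N , λ n n≥ → subst (ℚ._≤ seq x n) (ℚ.+-identityˡ c) (hN n n≥)))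

_/_ : ℝ⁺ → ℝ⁺ → ℝ
x / y = value x * y ⁻¹

exp : ℝ → ℝ⁺
exp x = mkℝ⁺ (mkℝ (λ n → euler (seq x n) n) (Sequences.cauchy-euler (seq x) (cauchy x)))
  (let c , 0<c , N , hN = Sequences.euler-positive (seq x) (cauchy x) in
   c , 0<c , N , λ n n≥ → subst (ℚ._≤ euler (seq x n) n) (sym (ℚ.+-identityˡ c)) (hN n n≥))

-- log d = - log (1 - (d - 1)/d), by the Mercator series.  The value at 0 is junk.
log : ℕ → ℝ
log zero    = fromℕ 0
log (suc k) = mkℝ (mercator (+ k ℚ./ suc k)) (Sequences.MercatorCauchy.mercator-cauchy k)

-- Real powers of positive integers.  The value at base 0 is junk; it never
-- enters, since endpoints of edges have positive degree.
_^_ : ℕ → ℝ → ℝ⁺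
d ^ α = exp (α * log d)

∑ : ∀ {A : Set} → List A → (A → ℝ) → ℝ
∑ xs f = foldr _+_ (fromℕ 0) (map f xs)

record SimpleGraph (n : ℕ) : Set₁ where
  field
    Adj     : Rel (Fin n) 0ℓ
    adj?    : Decidable Adj
    sym-adj : Symmetric Adj
    irrefl  : Irreflexive _≡_ Adj

module _ {n : ℕ} (G : SimpleGraph n) where
  open SimpleGraph G

  degree : Fin n → ℕ
  degree u = length (filter (adj? u) (allFin n))

  -- Each unordered edge is listed once, as the pair (u , v) with u < v.
  edges : List (Fin n × Fin n)
  edges = filter (λ (u , v) → (u Fin.<? v) ×-dec adj? u v)
                 (cartesianProduct (allFin n) (allFin n))

  IsMinDegree : ℕ → Set
  IsMinDegree δ = (∀ u → δ ℕ.≤ degree u) × (∃[ u ] degree u ≡ δ)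

  IsMaxDegree : ℕ → Set
  IsMaxDegree Δ = (∀ u → degree u ℕ.≤ Δ) × (∃[ u ] degree u ≡ Δ)

  -- The edges whose endpoints can be named u, v with P (deg u) (deg v).
  edgesWith : {P : Rel ℕ 0ℓ} → Decidable P → List (Fin n × Fin n)
  edgesWith P? = filter
    (λ (u , v) → P? (degree u) (degree v) ⊎-dec P? (degree v) (degree u)) edges

  F₀ F₁ F₂ : (δ Δ : ℕ) → List (Fin n × Fin n)
  F₀ δ Δ = edgesWith λ a b → (a ℕ.≟ δ) ×-dec (b ℕ.≟ Δ)
  F₁ δ Δ = edgesWith λ a b → (a ℕ.≟ δ) ×-dec ((δ ℕ.<? b) ×-dec (b ℕ.<? Δ))
  F₂ δ Δ = edgesWith λ a b → (a ℕ.≟ Δ) ×-dec ((δ ℕ.<? b) ×-dec (b ℕ.<? Δ))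

  SDD : ℝ → ℝ
  SDD α = ∑ edges λ (u , v) →
    degree u ^ α / degree v ^ α + degree v ^ α / degree u ^ α

{-# OPTIONS --safe #-}

-- For α > 0 the sequence representing d ^ α is eventually positive and monotone
-- in d term by term: the partial sums of the Mercator series increase with d, and
-- so does (1 + x/2ⁿ)^(2ⁿ) for x ≥ 0.  Both inequalities therefore hold between
-- rationals at every large index, for an arbitrary positive monotone weight P in
-- place of d ↦ d ^ α.  There they are summed edge by edge, since r + 1/r increases
-- for r ≥ 1, so P b / P a + P a / P b grows as the interval [ a , b ] grows.
module Submission where

open import Defs
open import Data.Bool.Base using (true; false; if_then_else_)
open import Data.Empty using (⊥; ⊥-elim)
open import Data.Fin.Base using (Fin)
open import Data.Integer.Base as ℤ using (+_; +≤+)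
import Data.Integer.Properties as ℤ
open import Data.List.Base using (List; []; _∷_; filter; foldr; length; map)
open import Data.Nat.Base as ℕ using (ℕ; zero; suc; _∸_)
import Data.Nat.Properties as ℕ
open import Data.Product.Base using (_×_; _,_; ∃-syntax)
open import Data.Rational.Base as ℚ using (ℚ; 0ℚ; 1ℚ; ½)
import Data.Rational.Properties as ℚ
open import Data.Rational.Solver using (module +-*-Solver)
import Data.Rational.Unnormalised.Base as ℚᵘ
import Data.Rational.Unnormalised.Properties as ℚᵘ
open import Data.Sum.Base using (_⊎_; inj₁; inj₂)
open import Relation.Binary.PropositionalEquality
open import Relation.Nullary using (Dec; yes; no; does)
open import Relation.Nullary.Decidable using (_×-dec_; _⊎-dec_)
open import Relation.Unary using (Pred; Decidable)
open +-*-Solver using (solve; con; _:=_; _:+_; _:*_; _:-_)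
open Sequences using (recip; mercator; euler; ι; ι-suc; 0≤1; 0<1; 0≤½; 0≤*; 0≤+; 0<^; 0≤^; ^-mono;
  *-mono; *-monoʳ; *-monoˡ; *-cancelˡ; p≤p+q; 0≤-⇒≤; ≤⇒0≤-; 0<recip; p*recip[p]≡1; recip-antimono)

eventually-≤⇒≤ : ∀ x y → ∃[ N ] (∀ n → N ℕ.≤ n → seq x n ℚ.≤ seq y n) → x ≤ y
eventually-≤⇒≤ x y (N , h) ε 0<ε = N , λ n N≤n → ℚ.≤-trans (h n N≤n) (p≤p+q (ℚ.<⇒≤ 0<ε))

-- Finite rational sums and counting by indicators.

sumMap : ∀ {A : Set} → (A → ℚ) → List A → ℚ
sumMap f xs = foldr ℚ._+_ 0ℚ (map f xs)

-- Branching on `does`, as `filter` does, lets a count and its indicator reduce by the same Boolean.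
indicator : ∀ {p} {P : Set p} → Dec P → ℚ
indicator P? = if does P? then 1ℚ else 0ℚ

module _ {A : Set} where

  seq-∑ : ∀ (xs : List A) f n → seq (∑ xs f) n ≡ sumMap (λ x → seq (f x) n) xs
  seq-∑ []       f n = refl
  seq-∑ (x ∷ xs) f n = cong (seq (f x) n ℚ.+_) (seq-∑ xs f n)

  sumMap-mono : ∀ {f g : A → ℚ} → (∀ x → f x ℚ.≤ g x) → ∀ xs → sumMap f xs ℚ.≤ sumMap g xs
  sumMap-mono f≤g []       = ℚ.≤-refl
  sumMap-mono f≤g (x ∷ xs) = ℚ.+-mono-≤ (f≤g x) (sumMap-mono f≤g xs)

  sumMap-+ : ∀ (f g : A → ℚ) xs → sumMap (λ x → f x ℚ.+ g x) xs ≡ sumMap f xs ℚ.+ sumMap g xs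
  sumMap-+ f g []       = refl
  sumMap-+ f g (x ∷ xs) = trans (cong (f x ℚ.+ g x ℚ.+_) (sumMap-+ f g xs))
    (solve 4 (λ a b c d → a :+ b :+ (c :+ d) := (a :+ c) :+ (b :+ d)) refl
      (f x) (g x) (sumMap f xs) (sumMap g xs))

  sumMap-const : ∀ c (xs : List A) → sumMap (λ _ → c) xs ≡ ι (length xs) ℚ.* c
  sumMap-const c []       = sym (ℚ.*-zeroˡ c)
  sumMap-const c (x ∷ xs) = begin
    c ℚ.+ sumMap (λ _ → c) xs       ≡⟨ cong (c ℚ.+_) (sumMap-const c xs) ⟩
    c ℚ.+ ι (length xs) ℚ.* c       ≡⟨ solve 2 (λ c i → c :+ i :* c := (con 1ℚ :+ i) :* c) refl c (ι (length xs)) ⟩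
    (1ℚ ℚ.+ ι (length xs)) ℚ.* c    ≡⟨ cong (ℚ._* c) (ι-suc (length xs)) ⟨
    ι (suc (length xs)) ℚ.* c       ∎
    where open ≡-Reasoning

  length-filter-∷ : ∀ {p} {P : Pred A p} (P? : Decidable P) x xs →
    ι (length (filter P? (x ∷ xs))) ≡ indicator (P? x) ℚ.+ ι (length (filter P? xs))
  length-filter-∷ P? x xs with does (P? x)
  ... | true  = ι-suc (length (filter P? xs))
  ... | false = sym (ℚ.+-identityˡ _)

  -- The cardinalities of the edge classes enter the bounds here, once each edge has been charged a
  -- fixed correction for every class containing it.
  sumMap-indicator : ∀ {p} {P : Pred A p} (P? : Decidable P) c xs →
    sumMap (λ x → indicator (P? x) ℚ.* c) xs ≡ ι (length (filter P? xs)) ℚ.* c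
  sumMap-indicator P? c []       = sym (ℚ.*-zeroˡ c)
  sumMap-indicator P? c (x ∷ xs) = begin
    i ℚ.* c ℚ.+ sumMap (λ x → indicator (P? x) ℚ.* c) xs  ≡⟨ cong (i ℚ.* c ℚ.+_) (sumMap-indicator P? c xs) ⟩
    i ℚ.* c ℚ.+ k ℚ.* c                                   ≡⟨ ℚ.*-distribʳ-+ c i k ⟨
    (i ℚ.+ k) ℚ.* c                                       ≡⟨ cong (ℚ._* c) (length-filter-∷ P? x xs) ⟨
    ι (length (filter P? (x ∷ xs))) ℚ.* c                 ∎
    where
    open ≡-Reasoning
    i = indicator (P? x)
    k = ι (length (filter P? xs))

-- The function r + 1/r and sums of two reciprocal ratios.

-- With r r′ = R R′ = 1, the difference of the two sides is (R - r)(1 - r′R′).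
r+1/r-mono : ∀ {r r′ R R′} → r ℚ.* r′ ≡ 1ℚ → R ℚ.* R′ ≡ 1ℚ → 0ℚ ℚ.≤ r′ → 0ℚ ℚ.≤ R′ →
  1ℚ ℚ.≤ r → r ℚ.≤ R → r ℚ.+ r′ ℚ.≤ R ℚ.+ R′
r+1/r-mono {r} {r′} {R} {R′} rr′≡1 RR′≡1 0≤r′ 0≤R′ 1≤r r≤R =
  0≤-⇒≤ (subst (0ℚ ℚ.≤_) eq (0≤* (≤⇒0≤- r≤R) (≤⇒0≤- r′R′≤1)))
  where
  inverse≤1 : ∀ {q q′} → q ℚ.* q′ ≡ 1ℚ → 0ℚ ℚ.≤ q′ → 1ℚ ℚ.≤ q → q′ ℚ.≤ 1ℚ
  inverse≤1 {q} {q′} qq′≡1 0≤q′ 1≤q =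
    subst₂ ℚ._≤_ (ℚ.*-identityˡ q′) qq′≡1 (*-monoˡ q′ 0≤q′ 1≤q)
  r′R′≤1 : r′ ℚ.* R′ ℚ.≤ 1ℚ
  r′R′≤1 = *-mono 0≤1 0≤R′ (inverse≤1 rr′≡1 0≤r′ 1≤r) (inverse≤1 RR′≡1 0≤R′ (ℚ.≤-trans 1≤r r≤R))
  open ≡-Reasoning
  eq : (R ℚ.- r) ℚ.* (1ℚ ℚ.- r′ ℚ.* R′) ≡ R ℚ.+ R′ ℚ.- (r ℚ.+ r′)
  eq = begin
    (R ℚ.- r) ℚ.* (1ℚ ℚ.- r′ ℚ.* R′)
      ≡⟨ solve 4 (λ r r′ R R′ → (R :- r) :* (con 1ℚ :- r′ :* R′)
           := R :+ (r :* r′) :* R′ :- (r :+ r′ :* (R :* R′))) refl r r′ R R′ ⟩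
    R ℚ.+ (r ℚ.* r′) ℚ.* R′ ℚ.- (r ℚ.+ r′ ℚ.* (R ℚ.* R′))
      ≡⟨ cong₂ (λ a b → R ℚ.+ a ℚ.* R′ ℚ.- (r ℚ.+ r′ ℚ.* b)) rr′≡1 RR′≡1 ⟩
    R ℚ.+ 1ℚ ℚ.* R′ ℚ.- (r ℚ.+ r′ ℚ.* 1ℚ)
      ≡⟨ cong₂ (λ a b → R ℚ.+ a ℚ.- (r ℚ.+ b)) (ℚ.*-identityˡ R′) (ℚ.*-identityʳ r′) ⟩
    R ℚ.+ R′ ℚ.- (r ℚ.+ r′) ∎

-- The edge summand of `SDD` at one index. With `recip` for division it agrees by computation with
-- the sequence of the real quotients.
ratioSum : ℚ → ℚ → ℚ
ratioSum p q = p ℚ.* recip q ℚ.+ q ℚ.* recip p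

ratioSum-comm : ∀ p q → ratioSum p q ≡ ratioSum q p
ratioSum-comm p q = ℚ.+-comm (p ℚ.* recip q) (q ℚ.* recip p)

module _ {p q : ℚ} (0<p : 0ℚ ℚ.< p) (0<q : 0ℚ ℚ.< q) where

  ratio-inverse : (q ℚ.* recip p) ℚ.* (p ℚ.* recip q) ≡ 1ℚ
  ratio-inverse = begin
    (q ℚ.* recip p) ℚ.* (p ℚ.* recip q)  ≡⟨ solve 4 (λ q p′ p q′ → (q :* p′) :* (p :* q′) := (p :* p′) :* (q :* q′)) refl q (recip p) p (recip q) ⟩
    (p ℚ.* recip p) ℚ.* (q ℚ.* recip q)  ≡⟨ cong₂ ℚ._*_ (p*recip[p]≡1 0<p) (p*recip[p]≡1 0<q) ⟩
    1ℚ ∎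
    where open ≡-Reasoning

  0≤ratio : 0ℚ ℚ.≤ p ℚ.* recip q
  0≤ratio = 0≤* (ℚ.<⇒≤ 0<p) (ℚ.<⇒≤ (0<recip 0<q))

  1≤ratio : p ℚ.≤ q → 1ℚ ℚ.≤ q ℚ.* recip p
  1≤ratio p≤q = subst (ℚ._≤ q ℚ.* recip p) (p*recip[p]≡1 0<p)
    (*-monoˡ (recip p) (ℚ.<⇒≤ (0<recip 0<p)) p≤q)

  -- The case r = 1/r = 1 of `r+1/r-mono`.
  2≤ratioSum : p ℚ.≤ q → ι 2 ℚ.≤ ratioSum q p
  2≤ratioSum p≤q = r+1/r-mono {1ℚ} {1ℚ} refl ratio-inverse 0≤1 0≤ratio ℚ.≤-refl (1≤ratio p≤q)

-- Lowering the denominator from x to z and raising the numerator from y to w enlarges a ratio that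
-- is already at least 1, where r + 1/r increases.
ratioSum-mono : ∀ {z x y w} → 0ℚ ℚ.< z → z ℚ.≤ x → x ℚ.≤ y → y ℚ.≤ w →
  ratioSum y x ℚ.≤ ratioSum w z
ratioSum-mono {z} {x} {y} {w} 0<z z≤x x≤y y≤w =
  r+1/r-mono (ratio-inverse 0<x 0<y) (ratio-inverse 0<z 0<w) (0≤ratio 0<x 0<y) (0≤ratio 0<z 0<w)
    (1≤ratio 0<x 0<y x≤y)
    (*-mono (ℚ.<⇒≤ 0<w) (ℚ.<⇒≤ (0<recip 0<x)) y≤w (recip-antimono 0<z z≤x))
  where
  0<x = ℚ.<-≤-trans 0<z z≤x
  0<y = ℚ.<-≤-trans 0<x x≤y
  0<w = ℚ.<-≤-trans 0<y y≤w

-- Edge bounds for a positive monotone weight.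

-- Each edge is listed once, with its ends in a fixed order, so a class must accept its degree
-- condition either way round, as `edgesWith` does.
Symmetrized : (ℕ → ℕ → Set) → ℕ → ℕ → Set
Symmetrized R a b = R a b ⊎ R b a

module PositiveMonotone (P : ℕ → ℚ) (0<P : ∀ d → 0ℚ ℚ.< P d)
  (P-mono : ∀ {a b} → a ℕ.≤ b → P a ℚ.≤ P b) where

  s : ℕ → ℕ → ℚ
  s a b = ratioSum (P a) (P b)

  s-comm : ∀ a b → s a b ≡ s b a
  s-comm a b = ratioSum-comm (P a) (P b)

  s-mono : ∀ {z x y w} → z ℕ.≤ x → x ℕ.≤ y → y ℕ.≤ w → s y x ℚ.≤ s w z
  s-mono {z} z≤x x≤y y≤w = ratioSum-mono (0<P z) (P-mono z≤x) (P-mono x≤y) (P-mono y≤w)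

  -- By symmetry the smaller degree may be taken first; the interval between the two degrees then
  -- lies inside [δ, Δ].
  s≤extreme : ∀ {δ Δ a b} → δ ℕ.≤ a → a ℕ.≤ Δ → δ ℕ.≤ b → b ℕ.≤ Δ → s a b ℚ.≤ s Δ δ
  s≤extreme {δ} {Δ} {a} {b} δ≤a a≤Δ δ≤b b≤Δ with ℕ.≤-total a b
  ... | inj₁ a≤b = subst (ℚ._≤ s Δ δ) (s-comm b a) (s-mono δ≤a a≤b b≤Δ)
  ... | inj₂ b≤a = s-mono δ≤b b≤a a≤Δ

  2≤s : ∀ a b → ι 2 ℚ.≤ s a b
  2≤s a b with ℕ.≤-total a b
  ... | inj₁ a≤b = subst (ι 2 ℚ.≤_) (s-comm b a) (2≤ratioSum (0<P a) (0<P b) (P-mono a≤b))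
  ... | inj₂ b≤a = 2≤ratioSum (0<P b) (0<P a) (P-mono b≤a)

  module Bounds (δ Δ : ℕ) (δ<Δ : δ ℕ.< Δ) where

    E₀ E₁ E₂ : ℕ → ℕ → Set
    E₀ a b = a ≡ δ × b ≡ Δ
    E₁ a b = a ≡ δ × δ ℕ.< b × b ℕ.< Δ
    E₂ a b = a ≡ Δ × δ ℕ.< b × b ℕ.< Δ

    δ≢Δ : δ ≢ Δ
    δ≢Δ = ℕ.<⇒≢ δ<Δ

    -- Disjointness of the classes ensures that at most one correction is active in the edge bounds
    -- below. Here one class has both degrees extreme, the other has one strictly between.
    E₀-E₁-disjoint : ∀ {a b} → Symmetrized E₀ a b → Symmetrized E₁ a b → ⊥
    E₀-E₁-disjoint (inj₁ (refl , refl)) (inj₁ (_ , _ , Δ<Δ)) = ℕ.<-irrefl refl Δ<Δ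
    E₀-E₁-disjoint (inj₁ (refl , refl)) (inj₂ (Δ≡δ , _))     = δ≢Δ (sym Δ≡δ)
    E₀-E₁-disjoint (inj₂ (refl , refl)) (inj₁ (Δ≡δ , _))     = δ≢Δ (sym Δ≡δ)
    E₀-E₁-disjoint (inj₂ (refl , refl)) (inj₂ (_ , _ , Δ<Δ)) = ℕ.<-irrefl refl Δ<Δ

    E₀-E₂-disjoint : ∀ {a b} → Symmetrized E₀ a b → Symmetrized E₂ a b → ⊥
    E₀-E₂-disjoint (inj₁ (refl , refl)) (inj₁ (δ≡Δ , _))     = δ≢Δ δ≡Δ
    E₀-E₂-disjoint (inj₁ (refl , refl)) (inj₂ (_ , δ<δ , _)) = ℕ.<-irrefl refl δ<δ
    E₀-E₂-disjoint (inj₂ (refl , refl)) (inj₁ (_ , δ<δ , _)) = ℕ.<-irrefl refl δ<δ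
    E₀-E₂-disjoint (inj₂ (refl , refl)) (inj₂ (δ≡Δ , _))     = δ≢Δ δ≡Δ

    -- In `E₁` the degrees are δ and something below Δ, so neither can be Δ.
    E₁-E₂-disjoint : ∀ {a b} → Symmetrized E₁ a b → Symmetrized E₂ a b → ⊥
    E₁-E₂-disjoint (inj₁ (refl , _))         (inj₁ (δ≡Δ , _))     = δ≢Δ δ≡Δ
    E₁-E₂-disjoint (inj₁ (_ , _ , b<Δ))      (inj₂ (refl , _))    = ℕ.<-irrefl refl b<Δ
    E₁-E₂-disjoint (inj₂ (_ , _ , a<Δ))      (inj₁ (refl , _))    = ℕ.<-irrefl refl a<Δ
    E₁-E₂-disjoint (inj₂ (refl , _))         (inj₂ (δ≡Δ , _))     = δ≢Δ δ≡Δ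

    module _ {a b : ℕ} where

      E₀⇒s : Symmetrized E₀ a b → s Δ δ ≡ s a b
      E₀⇒s (inj₁ (refl , refl)) = s-comm Δ δ
      E₀⇒s (inj₂ (refl , refl)) = refl

      -- The smaller end of the interval is δ and the larger ranges over [δ + 1, Δ - 1]; its two
      -- extreme positions give this bound and `E₁⇒≤s`.
      E₁⇒s≤ : Symmetrized E₁ a b → s a b ℚ.≤ s (Δ ∸ 1) δ
      E₁⇒s≤ (inj₁ (refl , δ<b , b<Δ)) = subst (ℚ._≤ s (Δ ∸ 1) δ) (s-comm b δ)
        (s-mono ℕ.≤-refl (ℕ.<⇒≤ δ<b) (ℕ.<⇒≤pred b<Δ))
      E₁⇒s≤ (inj₂ (refl , δ<a , a<Δ)) = s-mono ℕ.≤-refl (ℕ.<⇒≤ δ<a) (ℕ.<⇒≤pred a<Δ)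

      E₁⇒≤s : Symmetrized E₁ a b → s (suc δ) δ ℚ.≤ s a b
      E₁⇒≤s (inj₁ (refl , δ<b , _)) = subst (s (suc δ) δ ℚ.≤_) (s-comm b δ)
        (s-mono ℕ.≤-refl (ℕ.n≤1+n δ) δ<b)
      E₁⇒≤s (inj₂ (refl , δ<a , _)) = s-mono ℕ.≤-refl (ℕ.n≤1+n δ) δ<a

      -- Now the larger end is Δ and the smaller ranges over [δ + 1, Δ - 1]: the longest interval
      -- starts at δ + 1 and, for `E₂⇒≤s`, the shortest at Δ - 1.
      E₂⇒s≤ : Symmetrized E₂ a b → s a b ℚ.≤ s Δ (suc δ)
      E₂⇒s≤ (inj₁ (refl , δ<b , b<Δ)) = s-mono δ<b (ℕ.<⇒≤ b<Δ) ℕ.≤-refl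
      E₂⇒s≤ (inj₂ (refl , δ<a , a<Δ)) = subst (ℚ._≤ s Δ (suc δ)) (s-comm Δ a)
        (s-mono δ<a (ℕ.<⇒≤ a<Δ) ℕ.≤-refl)

      E₂⇒≤s : Symmetrized E₂ a b → s Δ (Δ ∸ 1) ℚ.≤ s a b
      E₂⇒≤s (inj₁ (refl , _ , b<Δ)) = s-mono (ℕ.<⇒≤pred b<Δ) (ℕ.m∸n≤m Δ 1) ℕ.≤-refl
      E₂⇒≤s (inj₂ (refl , _ , a<Δ)) = subst (s Δ (Δ ∸ 1) ℚ.≤_) (s-comm Δ a)
        (s-mono (ℕ.<⇒≤pred a<Δ) (ℕ.m∸n≤m Δ 1) ℕ.≤-refl)

      -- Every edge starts from the extreme value `s Δ δ`; membership in `E₁` or `E₂` replaces it by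
      -- the bound of that class. The additive form is what turns into cardinalities under
      -- summation.
      edge-upper : δ ℕ.≤ a → a ℕ.≤ Δ → δ ℕ.≤ b → b ℕ.≤ Δ →
        (e₁ : Dec (Symmetrized E₁ a b)) (e₂ : Dec (Symmetrized E₂ a b)) →
        s a b ℚ.≤ s Δ δ ℚ.+ indicator e₁ ℚ.* (s (Δ ∸ 1) δ ℚ.- s Δ δ)
                        ℚ.+ indicator e₂ ℚ.* (s Δ (suc δ) ℚ.- s Δ δ)
      edge-upper δ≤a a≤Δ δ≤b b≤Δ e₁ e₂ = go e₁ e₂
        where
        X = s Δ δ
        Y = s (Δ ∸ 1) δ
        Z = s Δ (suc δ)
        go : (e₁ : Dec (Symmetrized E₁ a b)) (e₂ : Dec (Symmetrized E₂ a b)) →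
          s a b ℚ.≤ X ℚ.+ indicator e₁ ℚ.* (Y ℚ.- X) ℚ.+ indicator e₂ ℚ.* (Z ℚ.- X)
        go (yes p) (yes q) = ⊥-elim (E₁-E₂-disjoint p q)
        go (yes p) (no _)  = subst (s a b ℚ.≤_)
          (solve 3 (λ X Y Z → Y := X :+ con 1ℚ :* (Y :- X) :+ con 0ℚ :* (Z :- X)) refl X Y Z) (E₁⇒s≤ p)
        go (no _)  (yes q) = subst (s a b ℚ.≤_)
          (solve 3 (λ X Y Z → Z := X :+ con 0ℚ :* (Y :- X) :+ con 1ℚ :* (Z :- X)) refl X Y Z) (E₂⇒s≤ q)
        -- The degrees are δ and Δ, two equal extremes, or two intermediate values; the extreme
        -- value covers them all.
        go (no _)  (no _)  = subst (s a b ℚ.≤_)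
          (solve 3 (λ X Y Z → X := X :+ con 0ℚ :* (Y :- X) :+ con 0ℚ :* (Z :- X)) refl X Y Z)
          (s≤extreme δ≤a a≤Δ δ≤b b≤Δ)

      -- The starting value is 2, the minimum of r + 1/r over r > 0. `E₀` gets a correction of its
      -- own because there the summand equals `s Δ δ`.
      edge-lower :
        (e₀ : Dec (Symmetrized E₀ a b)) (e₁ : Dec (Symmetrized E₁ a b)) (e₂ : Dec (Symmetrized E₂ a b)) →
        ι 2 ℚ.+ indicator e₀ ℚ.* (s Δ δ ℚ.- ι 2) ℚ.+ indicator e₁ ℚ.* (s (suc δ) δ ℚ.- ι 2)
            ℚ.+ indicator e₂ ℚ.* (s Δ (Δ ∸ 1) ℚ.- ι 2) ℚ.≤ s a b
      edge-lower e₀ e₁ e₂ = go e₀ e₁ e₂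
        where
        t = ι 2
        X = s Δ δ
        Y = s (suc δ) δ
        Z = s Δ (Δ ∸ 1)
        go : (e₀ : Dec (Symmetrized E₀ a b)) (e₁ : Dec (Symmetrized E₁ a b)) (e₂ : Dec (Symmetrized E₂ a b)) →
          t ℚ.+ indicator e₀ ℚ.* (X ℚ.- t) ℚ.+ indicator e₁ ℚ.* (Y ℚ.- t) ℚ.+ indicator e₂ ℚ.* (Z ℚ.- t)
            ℚ.≤ s a b
        go (yes o) (yes p) _       = ⊥-elim (E₀-E₁-disjoint o p)
        go (yes o) (no _)  (yes q) = ⊥-elim (E₀-E₂-disjoint o q)
        go (no _)  (yes p) (yes q) = ⊥-elim (E₁-E₂-disjoint p q)
        go (yes o) (no _)  (no _)  = subst (ℚ._≤ s a b)
          (solve 4 (λ t X Y Z → X := t :+ con 1ℚ :* (X :- t) :+ con 0ℚ :* (Y :- t) :+ con 0ℚ :* (Z :- t)) refl t X Y Z)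
          (ℚ.≤-reflexive (E₀⇒s o))
        go (no _)  (yes p) (no _)  = subst (ℚ._≤ s a b)
          (solve 4 (λ t X Y Z → Y := t :+ con 0ℚ :* (X :- t) :+ con 1ℚ :* (Y :- t) :+ con 0ℚ :* (Z :- t)) refl t X Y Z)
          (E₁⇒≤s p)
        go (no _)  (no _)  (yes q) = subst (ℚ._≤ s a b)
          (solve 4 (λ t X Y Z → Z := t :+ con 0ℚ :* (X :- t) :+ con 0ℚ :* (Y :- t) :+ con 1ℚ :* (Z :- t)) refl t X Y Z)
          (E₂⇒≤s q)
        go (no _)  (no _)  (no _)  = subst (ℚ._≤ s a b)
          (solve 4 (λ t X Y Z → t := t :+ con 0ℚ :* (X :- t) :+ con 0ℚ :* (Y :- t) :+ con 0ℚ :* (Z :- t)) refl t X Y Z)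
          (2≤s a b)

    -- Summation of the edge bounds over a list of edges.

    module _ {A : Set} (a b : A → ℕ)
      (e₀ : ∀ x → Dec (Symmetrized E₀ (a x) (b x)))
      (e₁ : ∀ x → Dec (Symmetrized E₁ (a x) (b x)))
      (e₂ : ∀ x → Dec (Symmetrized E₂ (a x) (b x))) (xs : List A) where

      private
        m  = ι (length xs)
        A₀ = ι (length (filter e₀ xs))
        A₁ = ι (length (filter e₁ xs))
        A₂ = ι (length (filter e₂ xs))

      sum-upper : (∀ x → δ ℕ.≤ a x) → (∀ x → a x ℕ.≤ Δ) → (∀ x → δ ℕ.≤ b x) → (∀ x → b x ℕ.≤ Δ) →
        sumMap (λ x → s (a x) (b x)) xs ℚ.≤
          (m ℚ.- A₁ ℚ.- A₂) ℚ.* s Δ δ ℚ.+ A₁ ℚ.* s (Δ ∸ 1) δ ℚ.+ A₂ ℚ.* s Δ (suc δ)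
      sum-upper δ≤a a≤Δ δ≤b b≤Δ = begin
        sumMap (λ x → s (a x) (b x)) xs
          ≤⟨ sumMap-mono (λ x → edge-upper (δ≤a x) (a≤Δ x) (δ≤b x) (b≤Δ x) (e₁ x) (e₂ x)) xs ⟩
        sumMap (λ x → X ℚ.+ f₁ x ℚ.+ f₂ x) xs
          ≡⟨ trans (sumMap-+ (λ x → X ℚ.+ f₁ x) f₂ xs) (cong (ℚ._+ sumMap f₂ xs) (sumMap-+ (λ _ → X) f₁ xs)) ⟩
        sumMap (λ _ → X) xs ℚ.+ sumMap f₁ xs ℚ.+ sumMap f₂ xs
          ≡⟨ cong₂ ℚ._+_ (cong₂ ℚ._+_ (sumMap-const X xs) (sumMap-indicator e₁ (Y ℚ.- X) xs))
               (sumMap-indicator e₂ (Z ℚ.- X) xs) ⟩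
        m ℚ.* X ℚ.+ A₁ ℚ.* (Y ℚ.- X) ℚ.+ A₂ ℚ.* (Z ℚ.- X)
          -- Collecting the multiples of X leaves as its coefficient the number of edges outside
          -- both classes.
          ≡⟨ solve 6 (λ m A₁ A₂ X Y Z → m :* X :+ A₁ :* (Y :- X) :+ A₂ :* (Z :- X)
               := (m :- A₁ :- A₂) :* X :+ A₁ :* Y :+ A₂ :* Z) refl m A₁ A₂ X Y Z ⟩
        (m ℚ.- A₁ ℚ.- A₂) ℚ.* X ℚ.+ A₁ ℚ.* Y ℚ.+ A₂ ℚ.* Z ∎
        where
        open ℚ.≤-Reasoning
        X = s Δ δ
        Y = s (Δ ∸ 1) δ
        Z = s Δ (suc δ)
        f₁ f₂ : A → ℚ
        f₁ x = indicator (e₁ x) ℚ.* (Y ℚ.- X)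
        f₂ x = indicator (e₂ x) ℚ.* (Z ℚ.- X)

      sum-lower :
        ι 2 ℚ.* m ℚ.+ A₀ ℚ.* (s Δ δ ℚ.- ι 2) ℚ.+ A₁ ℚ.* (s (suc δ) δ ℚ.- ι 2)
          ℚ.+ A₂ ℚ.* (s Δ (Δ ∸ 1) ℚ.- ι 2) ℚ.≤ sumMap (λ x → s (a x) (b x)) xs
      sum-lower = begin
        t ℚ.* m ℚ.+ A₀ ℚ.* (X ℚ.- t) ℚ.+ A₁ ℚ.* (Y ℚ.- t) ℚ.+ A₂ ℚ.* (Z ℚ.- t)
          -- The closed form is unfolded into sums first, so the counting lemmas are read from right
          -- to left.
          ≡⟨ cong₂ ℚ._+_ (cong₂ ℚ._+_ (cong₂ ℚ._+_
               (trans (ℚ.*-comm t m) (sym (sumMap-const t xs)))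
               (sym (sumMap-indicator e₀ (X ℚ.- t) xs))) (sym (sumMap-indicator e₁ (Y ℚ.- t) xs)))
               (sym (sumMap-indicator e₂ (Z ℚ.- t) xs)) ⟩
        sumMap (λ _ → t) xs ℚ.+ sumMap f₀ xs ℚ.+ sumMap f₁ xs ℚ.+ sumMap f₂ xs
          ≡⟨ trans (sumMap-+ (λ x → t ℚ.+ f₀ x ℚ.+ f₁ x) f₂ xs) (cong (ℚ._+ sumMap f₂ xs)
               (trans (sumMap-+ (λ x → t ℚ.+ f₀ x) f₁ xs) (cong (ℚ._+ sumMap f₁ xs)
                 (sumMap-+ (λ _ → t) f₀ xs)))) ⟨
        sumMap (λ x → t ℚ.+ f₀ x ℚ.+ f₁ x ℚ.+ f₂ x) xs
          ≤⟨ sumMap-mono (λ x → edge-lower (e₀ x) (e₁ x) (e₂ x)) xs ⟩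
        sumMap (λ x → s (a x) (b x)) xs ∎
        where
        open ℚ.≤-Reasoning
        t = ι 2
        X = s Δ δ
        Y = s (suc δ) δ
        Z = s Δ (Δ ∸ 1)
        f₀ f₁ f₂ : A → ℚ
        f₀ x = indicator (e₀ x) ℚ.* (X ℚ.- t)
        f₁ x = indicator (e₁ x) ℚ.* (Y ℚ.- t)
        f₂ x = indicator (e₂ x) ℚ.* (Z ℚ.- t)

-- Termwise monotonicity of the logarithm and the exponential.

-- For y ≥ 0 each term yⁱ/i is nondecreasing in y.
mercator-mono : ∀ {y z} → 0ℚ ℚ.≤ y → y ℚ.≤ z → ∀ n → mercator y n ℚ.≤ mercator z n
mercator-mono 0≤y y≤z zero    = ℚ.≤-refl
mercator-mono 0≤y y≤z (suc n) = ℚ.+-mono-≤ (mercator-mono 0≤y y≤z n)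
  (*-monoˡ (+ 1 ℚ./ suc n) (ℚ.nonNegative⁻¹ _ {{ℚ.normalize-nonNeg 1 (suc n)}}) (^-mono (suc n) 0≤y y≤z))

0≤mercator : ∀ {y} → 0ℚ ℚ.≤ y → ∀ n → 0ℚ ℚ.≤ mercator y n
0≤mercator 0≤y zero    = ℚ.≤-refl
0≤mercator 0≤y (suc n) = 0≤+ (0≤mercator 0≤y n)
  (0≤* (0≤^ (suc n) 0≤y) (ℚ.nonNegative⁻¹ _ {{ℚ.normalize-nonNeg 1 (suc n)}}))

-- These fractions are the Mercator arguments of `log`. Cross-multiplied, k(l + 1) ≤ l(k + 1) is k ≤
-- l with kl added to both sides.
k/[1+k]-mono : ∀ {k l} → k ℕ.≤ l → + k ℚ./ suc k ℚ.≤ + l ℚ./ suc l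
k/[1+k]-mono {k} {l} k≤l = ℚ.toℚᵘ-cancel-≤ (begin
  ℚ.toℚᵘ (+ k ℚ./ suc k)  ≃⟨ ℚ.toℚᵘ-fromℚᵘ (ℚᵘ.mkℚᵘ (+ k) k) ⟩
  ℚᵘ.mkℚᵘ (+ k) k         ≤⟨ ℚᵘ.*≤* (subst₂ ℤ._≤_ (ℤ.pos-* k (suc l)) (ℤ.pos-* l (suc k)) (+≤+ k*[1+l]≤l*[1+k])) ⟩
  ℚᵘ.mkℚᵘ (+ l) l         ≃⟨ ℚ.toℚᵘ-fromℚᵘ (ℚᵘ.mkℚᵘ (+ l) l) ⟨
  ℚ.toℚᵘ (+ l ℚ./ suc l)  ∎)
  where
  open ℚᵘ.≤-Reasoning
  k*[1+l]≤l*[1+k] : k ℕ.* suc l ℕ.≤ l ℕ.* suc k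
  k*[1+l]≤l*[1+k] = subst₂ ℕ._≤_ (sym (ℕ.*-suc k l)) (sym (trans (ℕ.*-suc l k) (cong (l ℕ.+_) (ℕ.*-comm l k))))
    (ℕ.+-monoˡ-≤ (k ℕ.* l) k≤l)

0≤log : ∀ d n → 0ℚ ℚ.≤ seq (log d) n
0≤log zero    n = ℚ.≤-refl
0≤log (suc k) n = 0≤mercator (Sequences.MercatorCauchy.0≤y k) n

log-mono : ∀ {a b} → a ℕ.≤ b → ∀ n → seq (log a) n ℚ.≤ seq (log b) n
-- The default value 0 of `log` at 0 lies below every other logarithm, so monotonicity extends to
-- base 0.
log-mono {b = b} ℕ.z≤n n = 0≤log b n
log-mono (ℕ.s≤s {k} k≤l) n =
  mercator-mono (Sequences.MercatorCauchy.0≤y k) (k/[1+k]-mono k≤l) n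

0≤x/2^n : ∀ {x} n → 0ℚ ℚ.≤ x → 0ℚ ℚ.≤ x ℚ.* ½ Sequences.^ n
0≤x/2^n n 0≤x = 0≤* 0≤x (0≤^ n 0≤½)

0<euler : ∀ {x} n → 0ℚ ℚ.≤ x → 0ℚ ℚ.< euler x n
0<euler n 0≤x = 0<^ (2 ℕ.^ n) (ℚ.<-≤-trans 0<1 (p≤p+q (0≤x/2^n n 0≤x)))

euler-mono : ∀ {x y} n → 0ℚ ℚ.≤ x → x ℚ.≤ y → euler x n ℚ.≤ euler y n
euler-mono n 0≤x x≤y = ^-mono (2 ℕ.^ n) (0≤+ 0≤1 (0≤x/2^n n 0≤x))
  (ℚ.+-monoʳ-≤ 1ℚ (*-monoˡ (½ Sequences.^ n) (0≤^ n 0≤½) x≤y))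

-- The weight `d ^ α` at a single index.

module PowerAtIndex (α : ℝ) (n : ℕ) (0≤α : 0ℚ ℚ.≤ seq α n) where

  power : ℕ → ℚ
  power d = seq (value (d ^ α)) n

  0<power : ∀ d → 0ℚ ℚ.< power d
  0<power d = 0<euler n (0≤* 0≤α (0≤log d n))

  power-mono : ∀ {a b} → a ℕ.≤ b → power a ℚ.≤ power b
  power-mono {a} a≤b = euler-mono n (0≤* 0≤α (0≤log a n)) (*-monoʳ (seq α n) 0≤α (log-mono a≤b n))

  open PositiveMonotone power 0<power power-mono public

-- Transfer of both bounds to `SDD`.

theorem8 : ∀ {n} (G : SimpleGraph n) (δ Δ : ℕ) →
    IsMinDegree G δ → IsMaxDegree G Δ → 1 ℕ.≤ δ → suc δ ℕ.< Δ →
    (α : ℝ) → fromℕ 0 < α →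
    let m  = fromℕ (length (edges G))
        A₀ = fromℕ (length (F₀ G δ Δ))
        A₁ = fromℕ (length (F₁ G δ Δ))
        A₂ = fromℕ (length (F₂ G δ Δ))
    in
      (SDD G α ≤
          (m - A₁ - A₂) * (Δ ^ α / δ ^ α + δ ^ α / Δ ^ α)
        + A₁ * ((Δ ∸ 1) ^ α / δ ^ α + δ ^ α / (Δ ∸ 1) ^ α)
        + A₂ * (Δ ^ α / suc δ ^ α + suc δ ^ α / Δ ^ α))
      ×
      (fromℕ 2 * m
        + A₀ * (Δ ^ α / δ ^ α + δ ^ α / Δ ^ α - fromℕ 2)
        + A₁ * (suc δ ^ α / δ ^ α + δ ^ α / suc δ ^ α - fromℕ 2)
        + A₂ * (Δ ^ α / (Δ ∸ 1) ^ α + (Δ ∸ 1) ^ α / Δ ^ α - fromℕ 2)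
       ≤ SDD G α)
theorem8 {k} G δ Δ (δ≤deg , _) (deg≤Δ , _) _ 1+δ<Δ α (c , 0<c , N , c≤α) =
  -- The N supplied by 0 < α serves both bounds: from there on the terms representing α are
  -- nonnegative, so the rational inequalities hold at each index.
  eventually-≤⇒≤ (SDD G α) upperBound (N , upper) , eventually-≤⇒≤ lowerBound (SDD G α) (N , lower)
  where
  Edge = Fin k × Fin k
  a b : Edge → ℕ
  a (u , _) = degree G u
  b (_ , v) = degree G v
  m A₀ A₁ A₂ upperBound lowerBound : ℝ
  m  = fromℕ (length (edges G))
  A₀ = fromℕ (length (F₀ G δ Δ))
  A₁ = fromℕ (length (F₁ G δ Δ))
  A₂ = fromℕ (length (F₂ G δ Δ))
  upperBound = (m - A₁ - A₂) * (Δ ^ α / δ ^ α + δ ^ α / Δ ^ α)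
    + A₁ * ((Δ ∸ 1) ^ α / δ ^ α + δ ^ α / (Δ ∸ 1) ^ α)
    + A₂ * (Δ ^ α / suc δ ^ α + suc δ ^ α / Δ ^ α)
  lowerBound = fromℕ 2 * m
    + A₀ * (Δ ^ α / δ ^ α + δ ^ α / Δ ^ α - fromℕ 2)
    + A₁ * (suc δ ^ α / δ ^ α + δ ^ α / suc δ ^ α - fromℕ 2)
    + A₂ * (Δ ^ α / (Δ ∸ 1) ^ α + (Δ ∸ 1) ^ α / Δ ^ α - fromℕ 2)
  0≤α : ∀ n → N ℕ.≤ n → 0ℚ ℚ.≤ seq α n
  0≤α n N≤n = ℚ.≤-trans (ℚ.<⇒≤ (subst (0ℚ ℚ.<_) (sym (ℚ.+-identityˡ c)) 0<c)) (c≤α n N≤n)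
  module At (n : ℕ) (N≤n : N ℕ.≤ n) where
    open PowerAtIndex α n (0≤α n N≤n) public
    open Bounds δ Δ (ℕ.<-trans (ℕ.n<1+n δ) 1+δ<Δ) public
    -- These decisions repeat those of `F₀`, `F₁` and `F₂`, so that filtering `edges G` by `e₀`,
    -- `e₁`, `e₂` yields those lists by computation.
    E₀? : ∀ i j → Dec (E₀ i j)
    E₀? i j = (i ℕ.≟ δ) ×-dec (j ℕ.≟ Δ)
    E₁? : ∀ i j → Dec (E₁ i j)
    E₁? i j = (i ℕ.≟ δ) ×-dec ((δ ℕ.<? j) ×-dec (j ℕ.<? Δ))
    E₂? : ∀ i j → Dec (E₂ i j)
    E₂? i j = (i ℕ.≟ Δ) ×-dec ((δ ℕ.<? j) ×-dec (j ℕ.<? Δ))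
    e₀ : ∀ x → Dec (Symmetrized E₀ (a x) (b x))
    e₀ x = E₀? (a x) (b x) ⊎-dec E₀? (b x) (a x)
    e₁ : ∀ x → Dec (Symmetrized E₁ (a x) (b x))
    e₁ x = E₁? (a x) (b x) ⊎-dec E₁? (b x) (a x)
    e₂ : ∀ x → Dec (Symmetrized E₂ (a x) (b x))
    e₂ x = E₂? (a x) (b x) ⊎-dec E₂? (b x) (a x)
    -- Only the sum over the edges needs an induction; the remaining arithmetic on ℝ is termwise and
    -- matches the rational bounds by computation.
    sumMap≡seq-SDD : sumMap (λ x → s (a x) (b x)) (edges G) ≡ seq (SDD G α) n
    sumMap≡seq-SDD = sym (seq-∑ (edges G) (λ (u , v) →
      degree G u ^ α / degree G v ^ α + degree G v ^ α / degree G u ^ α) n)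
  upper : ∀ n → N ℕ.≤ n → seq (SDD G α) n ℚ.≤ seq upperBound n
  upper n N≤n = subst (ℚ._≤ seq upperBound n) sumMap≡seq-SDD
    (sum-upper a b e₀ e₁ e₂ (edges G)
      (λ (u , _) → δ≤deg u) (λ (u , _) → deg≤Δ u) (λ (_ , v) → δ≤deg v) (λ (_ , v) → deg≤Δ v))
    where open At n N≤n
  lower : ∀ n → N ℕ.≤ n → seq lowerBound n ℚ.≤ seq (SDD G α) n
  lower n N≤n = subst (seq lowerBound n ℚ.≤_) sumMap≡seq-SDD
    (sum-lower a b e₀ e₁ e₂ (edges G))
    where open At n N≤n
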